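{- Let $p$ be a positive integer. Then for every real or complex number $x$, $$M(x,p) = e^x \varphi_p(x) + e^x\int_0^x \varphi_p(t)\,dt = e^x\sum_{k=0}^{p} S(p,k)\left(x^k+\frac{x^{k+1}}{k+1}\right),$$ where $M(x,p)=\sum_{n=1}^{\infty}\left(1^p+2^p+\dots+n^p\right)\frac{x^n}{n!}$.
   Context: $S(m,k)$ denotes the Stirling numbers of the second kind. The exponential polynomials are $\varphi_m(x)=\sum_{k=0}^{m} S(m,k)x^k$ for integers $m\ge 0$. For complex $x$ the integral is taken along the line segment from $0$ to $x$. -}

module Defs where

open import Algebra.Bundles.Raw using (RawSemiring)
import Algebra.Definitions.RawSemiring as RawSemiringDefinitions
open import Data.Integer.Base using (+_)
import Data.Integer.Base as ℤ
import Data.Integer.Properties as ℤₚ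
open import Data.Nat.Base as ℕ using (ℕ; zero; suc; _!; _⊔_)
open import Data.Nat.Properties using (_!≢0)
import Data.Nat.Properties as ℕₚ
open import Data.Product.Base using (_×_; _,_; proj₁; proj₂; ∃-syntax)
open import Data.Rational.Base using (ℚ; 0ℚ; 1ℚ; ½; mkℚ)
import Data.Rational.Base as Q
import Data.Rational.Properties as ℚₚ
open import Data.Rational.Solver using (module +-*-Solver)
import Data.Rational.Unnormalised.Base as ℚᵘ
import Data.Rational.Unnormalised.Properties as ℚᵘₚ
open import Level using (0ℓ)
open import Relation.Binary.PropositionalEquality
  using (_≡_; refl; sym; trans; cong; cong₂; subst; subst₂)

module Rational where

  open Q using (_+_; _*_; _-_; ∣_∣; _≤_; _<_; _/_)
  open +-*-Solver using (solve; _:=_; _:+_; _:*_; _:-_; :-_)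

  nat : ℕ → ℚ
  nat n = + n / 1

  half : ℚ → ℚ
  half q = q * ½

  half-pos : ∀ {q} → 0ℚ < q → 0ℚ < half q
  half-pos {q} p = subst (_< half q) (ℚₚ.*-zeroˡ ½) (ℚₚ.*-monoˡ-<-pos ½ p)

  half+half : ∀ q → half q + half q ≡ q
  half+half q = trans (sym (ℚₚ.*-distribˡ-+ q ½ ½)) (ℚₚ.*-identityʳ q)

  triangle : ∀ a b c → ∣ a - c ∣ ≤ ∣ a - b ∣ + ∣ b - c ∣
  triangle a b c = subst (λ q → ∣ q ∣ ≤ ∣ a - b ∣ + ∣ b - c ∣)
    (solve 3 (λ a b c → (a :- b) :+ (b :- c) := a :- c) refl a b c)
    (ℚₚ.∣p+q∣≤∣p∣+∣q∣ (a - b) (b - c))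

  ∣-∣-comm : ∀ a b → ∣ a - b ∣ ≡ ∣ b - a ∣
  ∣-∣-comm a b = trans (sym (ℚₚ.∣-p∣≡∣p∣ (a - b)))
    (cong ∣_∣ (solve 2 (λ a b → :- (a :- b) := b :- a) refl a b))

  mul-mono : ∀ {a b c d} → 0ℚ ≤ b → 0ℚ ≤ c → a ≤ c → b ≤ d → a * b ≤ c * d
  mul-mono {a} {b} {c} {d} 0≤b 0≤c a≤c b≤d = ℚₚ.≤-trans
    (ℚₚ.*-monoʳ-≤-nonNeg b {{Q.nonNegative 0≤b}} a≤c)
    (ℚₚ.*-monoˡ-≤-nonNeg c {{Q.nonNegative 0≤c}} b≤d)

  mul-nonneg : ∀ {a b} → 0ℚ ≤ a → 0ℚ ≤ b → 0ℚ ≤ a * b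
  mul-nonneg {a} {b} 0≤a 0≤b = subst (_≤ a * b) (ℚₚ.*-zeroʳ a)
    (ℚₚ.*-monoˡ-≤-nonNeg a {{Q.nonNegative 0≤a}} 0≤b)

  frac≃ : ∀ n d → Q.toℚᵘ (+ n / suc d) ℚᵘ.≃ (+ n ℚᵘ./ suc d)
  frac≃ n d = ℚₚ.toℚᵘ-fromℚᵘ (ℚᵘ.mkℚᵘ (+ n) d)

  frac-* : ∀ m c n d .{{_ : ℕ.NonZero c}} .{{_ : ℕ.NonZero d}} .{{_ : ℕ.NonZero (c ℕ.* d)}} →
           (+ m / c) * (+ n / d) ≡ + (m ℕ.* n) / (c ℕ.* d)
  frac-* m (suc c) n (suc d) = ℚₚ.toℚᵘ-injective (begin
    Q.toℚᵘ ((+ m / suc c) * (+ n / suc d))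
      ≈⟨ ℚₚ.toℚᵘ-homo-* (+ m / suc c) (+ n / suc d) ⟩
    Q.toℚᵘ (+ m / suc c) ℚᵘ.* Q.toℚᵘ (+ n / suc d)
      ≈⟨ ℚᵘₚ.*-cong (frac≃ m c) (frac≃ n d) ⟩
    (+ m ℚᵘ./ suc c) ℚᵘ.* (+ n ℚᵘ./ suc d)
      ≡⟨ cong (λ i → i ℚᵘ./ (suc c ℕ.* suc d)) (sym (ℤₚ.pos-* m n)) ⟩
    (+ (m ℕ.* n)) ℚᵘ./ (suc c ℕ.* suc d)
      ≈⟨ frac≃ (m ℕ.* n) (d ℕ.+ c ℕ.* suc d) ⟨
    Q.toℚᵘ (+ (m ℕ.* n) / (suc c ℕ.* suc d)) ∎)
    where open ℚᵘₚ.≃-Reasoning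

  frac-≤ : ∀ m c n d .{{_ : ℕ.NonZero c}} .{{_ : ℕ.NonZero d}} →
           m ℕ.* d ℕ.≤ n ℕ.* c → + m / c ≤ + n / d
  frac-≤ m (suc c) n (suc d) h = ℚₚ.toℚᵘ-cancel-≤
    (ℚᵘₚ.≤-respˡ-≃ (ℚᵘₚ.≃-sym (frac≃ m c)) (ℚᵘₚ.≤-respʳ-≃ (ℚᵘₚ.≃-sym (frac≃ n d))
      (ℚᵘ.*≤* (subst₂ ℤ._≤_ (ℤₚ.pos-* m (suc d)) (ℤₚ.pos-* n (suc c)) (ℤ.+≤+ h)))))

  frac-nonneg : ∀ n d .{{_ : ℕ.NonZero d}} → 0ℚ ≤ + n / d
  frac-nonneg n d = subst (_≤ + n / d) (ℚₚ.0/n≡0 1) (frac-≤ 0 1 n d ℕ.z≤n)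

  nat-+ : ∀ m n → nat (m ℕ.+ n) ≡ nat m + nat n
  nat-+ m n = ℚₚ.toℚᵘ-injective (begin
    Q.toℚᵘ (nat (m ℕ.+ n))                ≈⟨ frac≃ (m ℕ.+ n) 0 ⟩
    + (m ℕ.+ n) ℚᵘ./ 1                    ≡⟨ cong (ℚᵘ._/ 1) (sym lem) ⟩
    (+ m ℚᵘ./ 1) ℚᵘ.+ (+ n ℚᵘ./ 1)        ≈⟨ ℚᵘₚ.+-cong (frac≃ m 0) (frac≃ n 0) ⟨
    Q.toℚᵘ (nat m) ℚᵘ.+ Q.toℚᵘ (nat n)    ≈⟨ ℚₚ.toℚᵘ-homo-+ (nat m) (nat n) ⟨
    Q.toℚᵘ (nat m + nat n)                ∎)
    where
    open ℚᵘₚ.≃-Reasoning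
    lem : (+ m ℤ.* + 1) ℤ.+ (+ n ℤ.* + 1) ≡ + (m ℕ.+ n)
    lem = cong₂ ℤ._+_ (ℤₚ.*-identityʳ (+ m)) (ℤₚ.*-identityʳ (+ n))

  inverse : ∀ n → nat (suc n) * (+ 1 / suc n) ≡ 1ℚ
  inverse n = ℚₚ.≤-antisym
    (subst (_≤ 1ℚ) (sym eq) (frac-≤ (suc n ℕ.* 1) (1 ℕ.* suc n) 1 1 (ℕₚ.≤-reflexive lem)))
    (subst (1ℚ ≤_) (sym eq) (frac-≤ 1 1 (suc n ℕ.* 1) (1 ℕ.* suc n) (ℕₚ.≤-reflexive (sym lem))))
    where
    eq : nat (suc n) * (+ 1 / suc n) ≡ + (suc n ℕ.* 1) / (1 ℕ.* suc n)
    eq = frac-* (suc n) 1 1 (suc n)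
    lem : (suc n ℕ.* 1) ℕ.* 1 ≡ 1 ℕ.* (1 ℕ.* suc n)
    lem = trans (ℕₚ.*-identityʳ _) (trans (ℕₚ.*-comm (suc n) 1)
            (sym (ℕₚ.*-identityˡ (1 ℕ.* suc n))))

  archimedean : ∀ q → ∃[ n ] q ≤ nat (suc n)
  archimedean q@(mkℚ i d _) = ℤ.∣ i ∣ , ℚₚ.toℚᵘ-cancel-≤
    (ℚᵘₚ.≤-respʳ-≃ (ℚᵘₚ.≃-sym (frac≃ (suc ℤ.∣ i ∣) 0))
      (ℚᵘ.*≤* (subst₂ ℤ._≤_ (sym (ℤₚ.*-identityʳ i)) (ℤₚ.pos-* (suc ℤ.∣ i ∣) (suc d))
        (ℤₚ.≤-trans (i≤∣i∣ i) (ℤ.+≤+ (ℕₚ.≤-trans (ℕₚ.n≤1+n _) (ℕₚ.m≤m*n (suc ℤ.∣ i ∣) (suc d))))))))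
    where
    i≤∣i∣ : ∀ i → i ℤ.≤ + ℤ.∣ i ∣
    i≤∣i∣ (+ n)       = ℤₚ.≤-refl
    i≤∣i∣ ℤ.-[1+ n ]  = ℤ.-≤+

  frac-pos : ∀ n → 0ℚ < + 1 / suc n
  frac-pos n = ℚₚ.positive⁻¹ _ {{ℚₚ.normalize-pos 1 (suc n)}}

open Rational

------------------------------------------------------------------------
-- Real numbers: Cauchy sequences of rationals, considered up to _≈ᴿ_

Eventually : (ℕ → Set) → Set
Eventually P = ∃[ N ] (∀ n → N ℕ.≤ n → P n)

record ℝ : Set where
  constructor mkℝ
  field
    seq    : ℕ → ℚ
    cauchy : ∀ ε → 0ℚ Q.< ε →
             ∃[ N ] (∀ m n → N ℕ.≤ m → N ℕ.≤ n → Q.∣ seq m Q.- seq n ∣ Q.≤ ε)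

open ℝ

infix 4 _≈ᴿ_ _≤ᴿ_

_≈ᴿ_ : ℝ → ℝ → Set
x ≈ᴿ y = ∀ ε → 0ℚ Q.< ε → Eventually (λ n → Q.∣ seq x n Q.- seq y n ∣ Q.≤ ε)

_≤ᴿ_ : ℝ → ℝ → Set
x ≤ᴿ y = ∀ ε → 0ℚ Q.< ε → Eventually (λ n → seq x n Q.≤ seq y n Q.+ ε)

module RealLemmas where

  open Q using (_+_; _*_; _-_; -_; ∣_∣; _≤_; _<_; _/_)
  open +-*-Solver using (solve; _:=_; _:+_; _:*_; _:-_; :-_)

  bounded : ∀ x → ∃[ B ] Eventually (λ n → ∣ seq x n ∣ ≤ nat (suc B))
  bounded x with cauchy x 1ℚ (frac-pos 0)
  ... | N , close with archimedean (1ℚ + ∣ seq x N ∣)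
  ... | B , 1+∣xN∣≤B = B , N , λ n N≤n → begin
    ∣ seq x n ∣                           ≡⟨ cong ∣_∣ (solve 2 (λ a b → a := (a :- b) :+ b) refl (seq x n) (seq x N)) ⟩
    ∣ (seq x n - seq x N) + seq x N ∣     ≤⟨ ℚₚ.∣p+q∣≤∣p∣+∣q∣ (seq x n - seq x N) (seq x N) ⟩
    ∣ seq x n - seq x N ∣ + ∣ seq x N ∣   ≤⟨ ℚₚ.+-monoˡ-≤ ∣ seq x N ∣ (close n N N≤n ℕₚ.≤-refl) ⟩
    1ℚ + ∣ seq x N ∣                      ≤⟨ 1+∣xN∣≤B ⟩
    nat (suc B)                           ∎
    where open ℚₚ.≤-Reasoning

  +-close : ∀ {ε} a b c d → ∣ a - c ∣ ≤ half ε → ∣ b - d ∣ ≤ half ε →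
            ∣ (a + b) - (c + d) ∣ ≤ ε
  +-close {ε} a b c d p q = begin
    ∣ (a + b) - (c + d) ∣      ≡⟨ cong ∣_∣ (solve 4 (λ a b c d → (a :+ b) :- (c :+ d) := (a :- c) :+ (b :- d)) refl a b c d) ⟩
    ∣ (a - c) + (b - d) ∣      ≤⟨ ℚₚ.∣p+q∣≤∣p∣+∣q∣ (a - c) (b - d) ⟩
    ∣ a - c ∣ + ∣ b - d ∣      ≤⟨ ℚₚ.+-mono-≤ p q ⟩
    half ε + half ε            ≡⟨ half+half ε ⟩
    ε                          ∎
    where open ℚₚ.≤-Reasoning

  *-close : ∀ {δ A B} a b c d → 0ℚ ≤ A → ∣ a ∣ ≤ A → ∣ d ∣ ≤ B →
            ∣ a - c ∣ ≤ δ → ∣ b - d ∣ ≤ δ → ∣ (a * b) - (c * d) ∣ ≤ (A + B) * δ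
  *-close {δ} {A} {B} a b c d 0≤A a≤A d≤B p q = begin
    ∣ (a * b) - (c * d) ∣                  ≡⟨ cong ∣_∣ (solve 4 (λ a b c d → (a :* b) :- (c :* d) := a :* (b :- d) :+ d :* (a :- c)) refl a b c d) ⟩
    ∣ a * (b - d) + d * (a - c) ∣          ≤⟨ ℚₚ.∣p+q∣≤∣p∣+∣q∣ (a * (b - d)) (d * (a - c)) ⟩
    ∣ a * (b - d) ∣ + ∣ d * (a - c) ∣      ≡⟨ cong₂ _+_ (ℚₚ.∣p*q∣≡∣p∣*∣q∣ a (b - d)) (ℚₚ.∣p*q∣≡∣p∣*∣q∣ d (a - c)) ⟩
    ∣ a ∣ * ∣ b - d ∣ + ∣ d ∣ * ∣ a - c ∣  ≤⟨ ℚₚ.+-mono-≤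
                                               (mul-mono (ℚₚ.0≤∣p∣ (b - d)) 0≤A a≤A q)
                                               (mul-mono (ℚₚ.0≤∣p∣ (a - c)) (ℚₚ.≤-trans (ℚₚ.0≤∣p∣ d) d≤B) d≤B p) ⟩
    A * δ + B * δ                          ≡⟨ sym (ℚₚ.*-distribʳ-+ δ A B) ⟩
    (A + B) * δ                            ∎
    where open ℚₚ.≤-Reasoning

  scale-pos : ∀ c {ε} → 0ℚ < ε → 0ℚ < ε * (+ 1 / suc c)
  scale-pos c {ε} p = subst (_< ε * (+ 1 / suc c)) (ℚₚ.*-zeroˡ (+ 1 / suc c))
    (ℚₚ.*-monoˡ-<-pos (+ 1 / suc c) {{ℚₚ.normalize-pos 1 (suc c)}} p)

  rescale : ∀ c ε → nat (suc c) * (ε * (+ 1 / suc c)) ≡ ε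
  rescale c ε = trans
    (solve 3 (λ a b c → a :* (b :* c) := b :* (a :* c)) refl (nat (suc c)) ε (+ 1 / suc c))
    (trans (cong (ε *_) (inverse c)) (ℚₚ.*-identityʳ ε))

  left : ∀ {m n o} → m ⊔ n ℕ.≤ o → m ℕ.≤ o
  left {m} {n} h = ℕₚ.≤-trans (ℕₚ.m≤m⊔n m n) h

  right : ∀ {m n o} → m ⊔ n ℕ.≤ o → n ℕ.≤ o
  right {m} {n} h = ℕₚ.≤-trans (ℕₚ.m≤n⊔m m n) h

open RealLemmas

fromℚ : ℚ → ℝ
fromℚ q = mkℝ (λ _ → q) λ ε 0<ε → 0 , λ _ _ _ _ →
  subst (Q._≤ ε) (sym (cong Q.∣_∣ (ℚₚ.+-inverseʳ q))) (ℚₚ.<⇒≤ 0<ε)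

infix  8 -ᴿ_
infixl 7 _*ᴿ_
infixl 6 _+ᴿ_ _-ᴿ_

_+ᴿ_ : ℝ → ℝ → ℝ
x +ᴿ y = mkℝ (λ n → seq x n Q.+ seq y n) λ ε 0<ε →
  let M , p = cauchy x (half ε) (half-pos 0<ε)
      N , q = cauchy y (half ε) (half-pos 0<ε)
  in M ⊔ N , λ m n hm hn →
       +-close (seq x m) (seq y m) (seq x n) (seq y n)
         (p m n (left hm) (left hn)) (q m n (right {M} hm) (right {M} hn))

-ᴿ_ : ℝ → ℝ
-ᴿ x = mkℝ (λ n → Q.- seq x n) λ ε 0<ε →
  let N , p = cauchy x ε 0<ε
  in N , λ m n hm hn → subst (Q._≤ ε) (neg-∣-∣ (seq x m) (seq x n)) (p m n hm hn)
  where
  open +-*-Solver using (solve; _:=_; _:-_; :-_)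
  neg-∣-∣ : ∀ a b → Q.∣ a Q.- b ∣ ≡ Q.∣ (Q.- a) Q.- (Q.- b) ∣
  neg-∣-∣ a b = trans (∣-∣-comm a b)
    (cong Q.∣_∣ (solve 2 (λ a b → b :- a := (:- a) :- (:- b)) refl a b))

_-ᴿ_ : ℝ → ℝ → ℝ
x -ᴿ y = x +ᴿ (-ᴿ y)

_*ᴿ_ : ℝ → ℝ → ℝ
x *ᴿ y = mkℝ (λ n → seq x n Q.* seq y n) λ ε 0<ε →
  let A , K , a = bounded x
      B , L , b = bounded y
      C = A ℕ.+ suc B
      M , p = cauchy x (ε Q.* (+ 1 Q./ suc C)) (scale-pos C 0<ε)
      N , q = cauchy y (ε Q.* (+ 1 Q./ suc C)) (scale-pos C 0<ε)
  in (K ⊔ L) ⊔ (M ⊔ N) , λ m n hm hn →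
       subst (_ Q.≤_)
         (trans (cong (Q._* (ε Q.* (+ 1 Q./ suc C))) (sym (nat-+ (suc A) (suc B)))) (rescale C ε))
         (*-close (seq x m) (seq y m) (seq x n) (seq y n) (frac-nonneg (suc A) 1)
           (a m (left {K} (left {K ⊔ L} hm))) (b n (right {K} (left {K ⊔ L} hn)))
           (p m n (left {M} (right {K ⊔ L} hm)) (left {M} (right {K ⊔ L} hn)))
           (q m n (right {M} (right {K ⊔ L} hm)) (right {M} (right {K ⊔ L} hn))))

------------------------------------------------------------------------
-- Complex numbers

infix 5 _+i_

record ℂ : Set where
  constructor _+i_
  field
    re im : ℝ

open ℂ

infix  4 _≈_
infix  8 -_
infixl 7 _*_ _÷_
infixl 6 _+_ _-_

_≈_ : ℂ → ℂ → Set
z ≈ w = (re z ≈ᴿ re w) × (im z ≈ᴿ im w)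

ofℝ : ℝ → ℂ
ofℝ x = x +i fromℚ 0ℚ

ofℚ : ℚ → ℂ
ofℚ q = ofℝ (fromℚ q)

ofℕ : ℕ → ℂ
ofℕ n = ofℚ (+ n Q./ 1)

0ℂ 1ℂ : ℂ
0ℂ = ofℚ 0ℚ
1ℂ = ofℚ 1ℚ

_+_ _-_ _*_ : ℂ → ℂ → ℂ
z + w = (re z +ᴿ re w) +i (im z +ᴿ im w)
z - w = (re z -ᴿ re w) +i (im z -ᴿ im w)
z * w = ((re z *ᴿ re w) -ᴿ (im z *ᴿ im w)) +i ((re z *ᴿ im w) +ᴿ (im z *ᴿ re w))

-_ : ℂ → ℂ
- z = (-ᴿ re z) +i (-ᴿ im z)

_÷_ : ℂ → (n : ℕ) .{{_ : ℕ.NonZero n}} → ℂ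
z ÷ n = ofℚ (+ 1 Q./ n) * z

ℂ-rawSemiring : RawSemiring 0ℓ 0ℓ
ℂ-rawSemiring = record
  { Carrier = ℂ ; _≈_ = _≈_ ; _+_ = _+_ ; _*_ = _*_ ; 0# = 0ℂ ; 1# = 1ℂ }

open RawSemiringDefinitions ℂ-rawSemiring public using (_^_)

-- |z| ≤ ε for rational ε ≥ 0, squared to avoid the real square root
∣_∣≤_ : ℂ → ℚ → Set
∣ z ∣≤ ε = (re z *ᴿ re z) +ᴿ (im z *ᴿ im z) ≤ᴿ fromℚ (ε Q.* ε)

-- ∑< n f = f 0 + f 1 + ⋯ + f (n - 1)
∑< : ℕ → (ℕ → ℂ) → ℂ
∑< zero    f = 0ℂ
∑< (suc n) f = ∑< n f + f n

_⟶_ : (ℕ → ℂ) → ℂ → Set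
s ⟶ L = ∀ ε → 0ℚ Q.< ε → Eventually (λ n → ∣ s n - L ∣≤ ε)

HasSum : (ℕ → ℂ) → ℂ → Set
HasSum f S = (λ n → ∑< n f) ⟶ S

------------------------------------------------------------------------
-- The exponential function, as the sum of its power series

-- xⁿ / n!
expTerm : ℂ → ℕ → ℂ
expTerm x n = (x ^ n ÷ (n !)) {{n !≢0}}

module Norm where

  open Q using (_≤_; _<_; _/_; ∣_∣) renaming (_+_ to _⊕_; _*_ to _⊗_; _-_ to _⊖_)
  open +-*-Solver using (solve; _:=_; _:+_; _:*_; _:-_; :-_)
  open ℚₚ.≤-Reasoning

  -- the 1-norm of the k-th rational approximation to z
  ‖_‖ : ℂ → ℕ → ℚ
  ‖ z ‖ k = ∣ seq (re z) k ∣ ⊕ ∣ seq (im z) k ∣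

  ‖-‖-nonneg : ∀ z k → 0ℚ ≤ ‖ z ‖ k
  ‖-‖-nonneg z k = subst (_≤ ‖ z ‖ k) (ℚₚ.+-identityˡ 0ℚ)
    (ℚₚ.+-mono-≤ (ℚₚ.0≤∣p∣ (seq (re z) k)) (ℚₚ.0≤∣p∣ (seq (im z) k)))

  ‖-‖-* : ∀ z w k → ‖ z * w ‖ k ≤ ‖ z ‖ k ⊗ ‖ w ‖ k
  ‖-‖-* z w k = begin
    ∣ a ⊗ c ⊖ b ⊗ d ∣ ⊕ ∣ a ⊗ d ⊕ b ⊗ c ∣
      ≤⟨ ℚₚ.+-mono-≤ (ℚₚ.∣p-q∣≤∣p∣+∣q∣ (a ⊗ c) (b ⊗ d)) (ℚₚ.∣p+q∣≤∣p∣+∣q∣ (a ⊗ d) (b ⊗ c)) ⟩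
    (∣ a ⊗ c ∣ ⊕ ∣ b ⊗ d ∣) ⊕ (∣ a ⊗ d ∣ ⊕ ∣ b ⊗ c ∣)
      ≡⟨ cong₂ _⊕_ (cong₂ _⊕_ (ℚₚ.∣p*q∣≡∣p∣*∣q∣ a c) (ℚₚ.∣p*q∣≡∣p∣*∣q∣ b d))
                   (cong₂ _⊕_ (ℚₚ.∣p*q∣≡∣p∣*∣q∣ a d) (ℚₚ.∣p*q∣≡∣p∣*∣q∣ b c)) ⟩
    (∣ a ∣ ⊗ ∣ c ∣ ⊕ ∣ b ∣ ⊗ ∣ d ∣) ⊕ (∣ a ∣ ⊗ ∣ d ∣ ⊕ ∣ b ∣ ⊗ ∣ c ∣)
      ≡⟨ solve 4 (λ a b c d → (a :* c :+ b :* d) :+ (a :* d :+ b :* c) := (a :+ b) :* (c :+ d))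
           refl (∣ a ∣) (∣ b ∣) (∣ c ∣) (∣ d ∣) ⟩
    (∣ a ∣ ⊕ ∣ b ∣) ⊗ (∣ c ∣ ⊕ ∣ d ∣) ∎
    where
    a = seq (re z) k
    b = seq (im z) k
    c = seq (re w) k
    d = seq (im w) k

  ‖-‖-ofℚ : ∀ q k → 0ℚ ≤ q → ‖ ofℚ q ‖ k ≡ q
  ‖-‖-ofℚ q k 0≤q = trans (cong (_⊕ 0ℚ) (ℚₚ.0≤p⇒∣p∣≡p 0≤q)) (ℚₚ.+-identityʳ q)

  dist : ℂ → ℂ → ℕ → ℚ
  dist z w k = ∣ seq (re z) k ⊖ seq (re w) k ∣ ⊕ ∣ seq (im z) k ⊖ seq (im w) k ∣

  ∣re∣≤dist : ∀ z w k → ∣ seq (re z) k ⊖ seq (re w) k ∣ ≤ dist z w k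
  ∣re∣≤dist z w k = subst (_≤ dist z w k) (ℚₚ.+-identityʳ re-dist)
    (ℚₚ.+-monoʳ-≤ re-dist (ℚₚ.0≤∣p∣ (seq (im z) k ⊖ seq (im w) k)))
    where re-dist = ∣ seq (re z) k ⊖ seq (re w) k ∣

  ∣im∣≤dist : ∀ z w k → ∣ seq (im z) k ⊖ seq (im w) k ∣ ≤ dist z w k
  ∣im∣≤dist z w k = subst (_≤ dist z w k) (ℚₚ.+-identityˡ im-dist)
    (ℚₚ.+-monoˡ-≤ im-dist (ℚₚ.0≤∣p∣ (seq (re z) k ⊖ seq (re w) k)))
    where im-dist = ∣ seq (im z) k ⊖ seq (im w) k ∣

  ‖-‖-bounded : ∀ z → ∃[ B ] Eventually (λ k → ‖ z ‖ k ≤ nat B)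
  ‖-‖-bounded z =
    let A , M , a = bounded (re z)
        B , N , b = bounded (im z)
    in suc A ℕ.+ suc B , M ⊔ N , λ k hk →
      subst (‖ z ‖ k ≤_) (sym (nat-+ (suc A) (suc B)))
        (ℚₚ.+-mono-≤ (a k (left hk)) (b k (right {M} hk)))

module Majorant (x : ℂ) (K k₀ : ℕ) (‖x‖≤K : ∀ k → k₀ ℕ.≤ k → Norm.‖ x ‖ k Q.≤ nat K) where

  open Norm
  open Q using (_≤_; _<_; _/_; ∣_∣) renaming (_+_ to _⊕_; _*_ to _⊗_; _-_ to _⊖_)
  open +-*-Solver using (solve; _:=_; _:+_; _:*_; _:-_; :-_)
  open ℚₚ.≤-Reasoning

  -- the majorant Kⁱ / i!
  t : ℕ → ℚ
  t zero    = 1ℚ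
  t (suc i) = (+ 1 / suc i ⊗ nat K) ⊗ t i

  t-nonneg : ∀ i → 0ℚ ≤ t i
  t-nonneg zero    = frac-nonneg 1 1
  t-nonneg (suc i) = mul-nonneg (mul-nonneg (frac-nonneg 1 (suc i)) (frac-nonneg K 1)) (t-nonneg i)

  ‖power‖ : ℕ → ℕ → ℚ
  ‖power‖ i k = (+ 1 / i !) {{i !≢0}} ⊗ ‖ x ^ i ‖ k

  ‖power‖≤t : ∀ k → k₀ ℕ.≤ k → ∀ i → ‖power‖ i k ≤ t i
  ‖power‖≤t k h zero    = ℚₚ.≤-refl
  ‖power‖≤t k h (suc i) = begin
    (+ 1 / suc i !) ⊗ ‖ x * x ^ i ‖ k
      ≤⟨ ℚₚ.*-monoˡ-≤-nonNeg (+ 1 / suc i !) {{Q.nonNegative (frac-nonneg 1 (suc i !))}} (‖-‖-* x (x ^ i) k) ⟩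
    (+ 1 / suc i !) ⊗ (‖ x ‖ k ⊗ ‖ x ^ i ‖ k)
      ≡⟨ cong (_⊗ (‖ x ‖ k ⊗ ‖ x ^ i ‖ k)) (sym (frac-* 1 (suc i) 1 (i !))) ⟩
    (+ 1 / suc i ⊗ (+ 1 / i !)) ⊗ (‖ x ‖ k ⊗ ‖ x ^ i ‖ k)
      ≡⟨ solve 4 (λ a b c d → (a :* b) :* (c :* d) := (a :* c) :* (b :* d)) refl
           (+ 1 / suc i) (+ 1 / i !) (‖ x ‖ k) (‖ x ^ i ‖ k) ⟩
    (+ 1 / suc i ⊗ ‖ x ‖ k) ⊗ ‖power‖ i k
      ≤⟨ mul-mono
           (mul-nonneg (frac-nonneg 1 (i !)) (‖-‖-nonneg (x ^ i) k))
           (mul-nonneg (frac-nonneg 1 (suc i)) (frac-nonneg K 1))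
           (ℚₚ.*-monoˡ-≤-nonNeg (+ 1 / suc i) {{Q.nonNegative (frac-nonneg 1 (suc i))}}
             (‖x‖≤K k h))
           (‖power‖≤t k h i) ⟩
    (+ 1 / suc i ⊗ nat K) ⊗ t i ∎
    where
    instance
      _ = i !≢0
      _ = suc i !≢0

  ‖term‖≤t : ∀ k → k₀ ℕ.≤ k → ∀ i → ‖ expTerm x i ‖ k ≤ t i
  ‖term‖≤t k h i = begin
    ‖ expTerm x i ‖ k                        ≤⟨ ‖-‖-* (ofℚ (+ 1 / i !)) (x ^ i) k ⟩
    ‖ ofℚ (+ 1 / i !) ‖ k ⊗ ‖ x ^ i ‖ k      ≡⟨ cong (_⊗ ‖ x ^ i ‖ k) (‖-‖-ofℚ (+ 1 / i !) k (frac-nonneg 1 (i !))) ⟩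
    ‖power‖ i k                              ≤⟨ ‖power‖≤t k h i ⟩
    t i                                      ∎
    where instance _ = i !≢0

  2K : ℕ
  2K = 2 ℕ.* K

  t-halves : ∀ i → 2K ℕ.≤ i → t (suc i) ≤ half (t i)
  t-halves i h = subst (t (suc i) ≤_) (ℚₚ.*-comm ½ (t i))
    (ℚₚ.*-monoʳ-≤-nonNeg (t i) {{Q.nonNegative (t-nonneg i)}}
      (subst (_≤ ½) (sym (frac-* 1 (suc i) K 1))
        (frac-≤ (1 ℕ.* K) (suc i ℕ.* 1) 1 2
          (subst₂ ℕ._≤_
            (trans (ℕₚ.*-comm 2 K) (cong (ℕ._* 2) (sym (ℕₚ.*-identityˡ K))))
            (sym (trans (ℕₚ.*-identityˡ (suc i ℕ.* 1)) (ℕₚ.*-identityʳ (suc i))))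
            (ℕₚ.m≤n⇒m≤1+n h)))))

  partial : ℕ → ℂ
  partial n = ∑< n (expTerm x)

  dist-refl : ∀ z k → dist z z k ≡ 0ℚ
  dist-refl z k = trans (cong₂ _⊕_ (self (seq (re z) k)) (self (seq (im z) k))) (ℚₚ.+-identityˡ 0ℚ)
    where
    self : ∀ q → ∣ q ⊖ q ∣ ≡ 0ℚ
    self q = cong ∣_∣ (ℚₚ.+-inverseʳ q)

  ∣-∣-step : ∀ a b c → ∣ (a ⊕ b) ⊖ c ∣ ≤ ∣ a ⊖ c ∣ ⊕ ∣ b ∣
  ∣-∣-step a b c = subst (λ q → ∣ q ∣ ≤ ∣ a ⊖ c ∣ ⊕ ∣ b ∣)
    (solve 3 (λ a b c → (a :- c) :+ b := (a :+ b) :- c) refl a b c)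
    (ℚₚ.∣p+q∣≤∣p∣+∣q∣ (a ⊖ c) b)

  dist-step : ∀ z w v k → dist (z + w) v k ≤ dist z v k ⊕ ‖ w ‖ k
  dist-step z w v k = subst (dist (z + w) v k ≤_)
    (solve 4 (λ a b c d → (a :+ b) :+ (c :+ d) := (a :+ c) :+ (b :+ d)) refl
      (∣ a ⊖ c ∣) (∣ a′ ∣) (∣ b ⊖ d ∣) (∣ b′ ∣))
    (ℚₚ.+-mono-≤ (∣-∣-step a a′ c) (∣-∣-step b b′ d))
    where
    a = seq (re z) k
    b = seq (im z) k
    a′ = seq (re w) k
    b′ = seq (im w) k
    c = seq (re v) k
    d = seq (im v) k

  tail-bound : ∀ k → k₀ ℕ.≤ k → ∀ m → 2K ℕ.≤ m → ∀ j →
               dist (partial (j ℕ.+ m)) (partial m) k ⊕ (t (j ℕ.+ m) ⊕ t (j ℕ.+ m)) ≤ t m ⊕ t m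
  tail-bound k hk m hm zero = ℚₚ.≤-reflexive
    (trans (cong (_⊕ (t m ⊕ t m)) (dist-refl (partial m) k)) (ℚₚ.+-identityˡ (t m ⊕ t m)))
  tail-bound k hk m hm (suc j) = begin
    dist (partial i + expTerm x i) (partial m) k ⊕ (t (suc i) ⊕ t (suc i))
      ≤⟨ ℚₚ.+-mono-≤ (dist-step (partial i) (expTerm x i) (partial m) k)
                     (ℚₚ.+-mono-≤ halves halves) ⟩
    (dist (partial i) (partial m) k ⊕ ‖ expTerm x i ‖ k) ⊕ (half (t i) ⊕ half (t i))
      ≤⟨ ℚₚ.+-mono-≤ (ℚₚ.+-monoʳ-≤ (dist (partial i) (partial m) k) (‖term‖≤t k hk i))
                     (ℚₚ.≤-reflexive (half+half (t i))) ⟩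
    (dist (partial i) (partial m) k ⊕ t i) ⊕ t i
      ≡⟨ ℚₚ.+-assoc (dist (partial i) (partial m) k) (t i) (t i) ⟩
    dist (partial i) (partial m) k ⊕ (t i ⊕ t i)
      ≤⟨ tail-bound k hk m hm j ⟩
    t m ⊕ t m ∎
    where
    i = j ℕ.+ m
    halves = t-halves i (ℕₚ.≤-trans hm (ℕₚ.m≤n+m m j))

  t-decay : ∀ m → 2K ℕ.≤ m → ∀ j → t (j ℕ.+ m) ⊗ nat (suc j) ≤ t m
  t-decay m hm zero    = ℚₚ.≤-reflexive (ℚₚ.*-identityʳ (t m))
  t-decay m hm (suc j) = begin
    t (suc i) ⊗ nat (suc (suc j))
      ≤⟨ ℚₚ.*-monoʳ-≤-nonNeg (nat (suc (suc j))) {{Q.nonNegative (frac-nonneg (suc (suc j)) 1)}}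
           (t-halves i (ℕₚ.≤-trans hm (ℕₚ.m≤n+m m j))) ⟩
    (t i ⊗ ½) ⊗ nat (suc (suc j))
      ≤⟨ ℚₚ.*-monoˡ-≤-nonNeg (t i ⊗ ½) {{Q.nonNegative (mul-nonneg (t-nonneg i) (frac-nonneg 1 2))}}
           (frac-≤ (suc (suc j)) 1 (suc j ℕ.+ suc j) 1
             (ℕₚ.*-monoˡ-≤ 1 (ℕ.s≤s (ℕₚ.m≤n+m (suc j) j)))) ⟩
    (t i ⊗ ½) ⊗ nat (suc j ℕ.+ suc j)
      ≡⟨ cong ((t i ⊗ ½) ⊗_) (nat-+ (suc j) (suc j)) ⟩
    (t i ⊗ ½) ⊗ (nat (suc j) ⊕ nat (suc j))
      ≡⟨ solve 3 (λ a h n → (a :* h) :* (n :+ n) := a :* (n :* h :+ n :* h)) refl (t i) ½ (nat (suc j)) ⟩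
    t i ⊗ (half (nat (suc j)) ⊕ half (nat (suc j)))
      ≡⟨ cong (t i ⊗_) (half+half (nat (suc j))) ⟩
    t i ⊗ nat (suc j)
      ≤⟨ t-decay m hm j ⟩
    t m ∎
    where i = j ℕ.+ m

  t-small : ∀ ε → 0ℚ < ε → ∃[ M ] (2K ℕ.≤ M × t M ⊕ t M ≤ ε)
  t-small ε 0<ε = j ℕ.+ 2K , ℕₚ.m≤n+m 2K j ,
    ℚₚ.*-cancelʳ-≤-pos N {{ℚₚ.normalize-pos (suc j) 1}} (begin
      (t M ⊕ t M) ⊗ N            ≡⟨ ℚₚ.*-distribʳ-+ N (t M) (t M) ⟩
      t M ⊗ N ⊕ t M ⊗ N          ≤⟨ ℚₚ.+-mono-≤ (t-decay 2K ℕₚ.≤-refl j) (t-decay 2K ℕₚ.≤-refl j) ⟩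
      c                          ≡⟨ ℚₚ.*-identityˡ c ⟨
      1ℚ ⊗ c                     ≡⟨ cong (_⊗ c) (ℚₚ.*-inverseʳ ε) ⟨
      (ε ⊗ (Q.1/ ε)) ⊗ c         ≡⟨ ℚₚ.*-assoc ε (Q.1/ ε) c ⟩
      ε ⊗ ((Q.1/ ε) ⊗ c)         ≤⟨ ℚₚ.*-monoˡ-≤-nonNeg ε {{Q.nonNegative (ℚₚ.<⇒≤ 0<ε)}} (proj₂ arch) ⟩
      ε ⊗ N                      ∎)
    where
    instance
      _ = ℚₚ.pos⇒nonZero ε {{Q.positive 0<ε}}
    c = t 2K ⊕ t 2K
    arch = archimedean ((Q.1/ ε) ⊗ c)
    j = proj₁ arch
    M = j ℕ.+ 2K
    N = nat (suc j)

  tail : ∀ ε → 0ℚ < ε →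
         ∃[ M ] (∀ n k → M ℕ.≤ n → k₀ ℕ.≤ k → dist (partial n) (partial M) k ≤ ε)
  tail ε 0<ε =
    let M , hM , small = t-small ε 0<ε
    in M , λ n k hn hk →
      let j = n ℕ.∸ M
          d = dist (partial (j ℕ.+ M)) (partial M) k
      in subst (λ n → dist (partial n) (partial M) k ≤ ε) (ℕₚ.m∸n+n≡m hn) (begin
           d                                       ≡⟨ ℚₚ.+-identityʳ d ⟨
           d ⊕ 0ℚ                                  ≤⟨ ℚₚ.+-monoʳ-≤ d (ℚₚ.+-mono-≤ (t-nonneg (j ℕ.+ M)) (t-nonneg (j ℕ.+ M))) ⟩
           d ⊕ (t (j ℕ.+ M) ⊕ t (j ℕ.+ M))         ≤⟨ tail-bound k hk M hM j ⟩
           t M ⊕ t M                               ≤⟨ small ⟩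
           ε                                       ∎)

  -- the diagonal sequence of a component of the partial sums is Cauchy
  diagonal : (c : ℂ → ℝ) → (∀ z w k → ∣ seq (c z) k ⊖ seq (c w) k ∣ ≤ dist z w k) → ℝ
  diagonal c c≤dist = mkℝ (λ n → seq (c (partial n)) n) λ ε 0<ε →
    let M , close = tail (half (half ε)) (half-pos (half-pos 0<ε))
        N , p = cauchy (c (partial M)) (half ε) (half-pos 0<ε)
    in (M ⊔ k₀) ⊔ N , λ m n hm hn →
      let a = seq (c (partial m)) m
          b = seq (c (partial M)) m
          b′ = seq (c (partial M)) n
          a′ = seq (c (partial n)) n
          near = λ i (hi : (M ⊔ k₀) ⊔ N ℕ.≤ i) → ℚₚ.≤-trans (c≤dist (partial i) (partial M) i)
                   (close i i (left {M} (left {M ⊔ k₀} hi)) (right {M} (left {M ⊔ k₀} hi)))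
      in begin
        ∣ a ⊖ a′ ∣                                        ≤⟨ triangle a b a′ ⟩
        ∣ a ⊖ b ∣ ⊕ ∣ b ⊖ a′ ∣                            ≤⟨ ℚₚ.+-monoʳ-≤ ∣ a ⊖ b ∣ (triangle b b′ a′) ⟩
        ∣ a ⊖ b ∣ ⊕ (∣ b ⊖ b′ ∣ ⊕ ∣ b′ ⊖ a′ ∣)            ≤⟨ ℚₚ.+-mono-≤ (near m hm) (ℚₚ.+-mono-≤
                                                               (p m n (right {M ⊔ k₀} hm) (right {M ⊔ k₀} hn))
                                                               (subst (_≤ half (half ε)) (∣-∣-comm a′ b′) (near n hn))) ⟩
        half (half ε) ⊕ (half ε ⊕ half (half ε))          ≡⟨ solve 2 (λ h e → h :+ (e :+ h) := e :+ (h :+ h)) refl (half (half ε)) (half ε) ⟩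
        half ε ⊕ (half (half ε) ⊕ half (half ε))          ≡⟨ cong (half ε ⊕_) (half+half (half ε)) ⟩
        half ε ⊕ half ε                                   ≡⟨ half+half ε ⟩
        ε                                                 ∎

  expSum : ℂ
  expSum = diagonal re ∣re∣≤dist +i diagonal im ∣im∣≤dist

  dist-triangle : ∀ z w v k → dist z v k ≤ dist z w k ⊕ dist v w k
  dist-triangle z w v k = subst (dist z v k ≤_)
    (trans
      (solve 4 (λ a b c d → (a :+ b) :+ (c :+ d) := (a :+ c) :+ (b :+ d)) refl
        (∣ a ⊖ c ∣) (∣ c ⊖ e ∣) (∣ b ⊖ d ∣) (∣ d ⊖ f ∣))
      (cong (dist z w k ⊕_) (cong₂ _⊕_ (∣-∣-comm c e) (∣-∣-comm d f))))
    (ℚₚ.+-mono-≤ (triangle a c e) (triangle b d f))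
    where
    a = seq (re z) k
    b = seq (im z) k
    c = seq (re w) k
    d = seq (im w) k
    e = seq (re v) k
    f = seq (im v) k

  square-sum : ∀ a b ε → ∣ a ∣ ⊕ ∣ b ∣ ≤ ε → a ⊗ a ⊕ b ⊗ b ≤ ε ⊗ ε
  square-sum a b ε h = begin
    a ⊗ a ⊕ b ⊗ b                              ≤⟨ ℚₚ.+-mono-≤ (square a) (square b) ⟩
    ∣ a ∣ ⊗ ∣ a ∣ ⊕ ∣ b ∣ ⊗ ∣ b ∣              ≡⟨ ℚₚ.+-identityʳ (∣ a ∣ ⊗ ∣ a ∣ ⊕ ∣ b ∣ ⊗ ∣ b ∣) ⟨
    ∣ a ∣ ⊗ ∣ a ∣ ⊕ ∣ b ∣ ⊗ ∣ b ∣ ⊕ 0ℚ         ≤⟨ ℚₚ.+-monoʳ-≤ (∣ a ∣ ⊗ ∣ a ∣ ⊕ ∣ b ∣ ⊗ ∣ b ∣)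
                                                    (ℚₚ.+-mono-≤ ab≥0 ab≥0) ⟩
    ∣ a ∣ ⊗ ∣ a ∣ ⊕ ∣ b ∣ ⊗ ∣ b ∣ ⊕ (∣ a ∣ ⊗ ∣ b ∣ ⊕ ∣ a ∣ ⊗ ∣ b ∣)
      ≡⟨ solve 2 (λ a b → (a :* a :+ b :* b) :+ (a :* b :+ a :* b) := (a :+ b) :* (a :+ b)) refl (∣ a ∣) (∣ b ∣) ⟩
    (∣ a ∣ ⊕ ∣ b ∣) ⊗ (∣ a ∣ ⊕ ∣ b ∣)          ≤⟨ mul-mono sum≥0 (ℚₚ.≤-trans sum≥0 h) h h ⟩
    ε ⊗ ε                                      ∎
    where
    ab≥0 = mul-nonneg (ℚₚ.0≤∣p∣ a) (ℚₚ.0≤∣p∣ b)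
    sum≥0 : 0ℚ ≤ ∣ a ∣ ⊕ ∣ b ∣
    sum≥0 = ℚₚ.+-mono-≤ (ℚₚ.0≤∣p∣ a) (ℚₚ.0≤∣p∣ b)
    square : ∀ a → a ⊗ a ≤ ∣ a ∣ ⊗ ∣ a ∣
    square a = subst (a ⊗ a ≤_) (ℚₚ.∣p*q∣≡∣p∣*∣q∣ a a) (p≤∣p∣ (a ⊗ a))
      where
      p≤∣p∣ : ∀ p → p ≤ ∣ p ∣
      p≤∣p∣ p@(mkℚ (+ _) _ _)         = ℚₚ.≤-refl
      p≤∣p∣ p@(mkℚ ℤ.-[1+ _ ] _ _)    = ℚₚ.≤-trans (ℚₚ.nonPositive⁻¹ p) (ℚₚ.0≤∣p∣ p)

  expSum-hasSum : HasSum (expTerm x) expSum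
  expSum-hasSum ε 0<ε =
    let M , close = tail (half ε) (half-pos 0<ε)
    in M , λ n hn η 0<η → M ⊔ k₀ , λ k hk →
      let near = close k k (left hk) (right {M} hk)
          bound = ℚₚ.≤-trans (dist-triangle (partial n) (partial M) (partial k) k)
                    (subst (dist (partial n) (partial M) k ⊕ dist (partial k) (partial M) k ≤_)
                      (half+half ε) (ℚₚ.+-mono-≤ (close n k hn (right {M} hk)) near))
          le = square-sum (seq (re (partial n)) k ⊖ seq (re (partial k)) k)
                          (seq (im (partial n)) k ⊖ seq (im (partial k)) k) ε bound
      in ℚₚ.≤-trans le (subst (_≤ ε ⊗ ε ⊕ η) (ℚₚ.+-identityʳ (ε ⊗ ε))
           (ℚₚ.+-monoʳ-≤ (ε ⊗ ε) (ℚₚ.<⇒≤ 0<η)))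

expSeries-converges : ∀ x → ∃[ e ] HasSum (expTerm x) e
expSeries-converges x =
  let K , k₀ , h = Norm.‖-‖-bounded x
  in Majorant.expSum x K k₀ h , Majorant.expSum-hasSum x K k₀ h

exp : ℂ → ℂ
exp x = proj₁ (expSeries-converges x)

------------------------------------------------------------------------
-- Integral along the segment from 0 to x

record TaggedPartition : Set where
  field
    size        : ℕ
    point tag   : ℕ → ℝ
    point-first : point 0 ≈ᴿ fromℚ 0ℚ
    point-last  : point size ≈ᴿ fromℚ 1ℚ
    point≤tag   : ∀ i → i ℕ.< size → point i ≤ᴿ tag i
    tag≤point   : ∀ i → i ℕ.< size → tag i ≤ᴿ point (suc i)

MeshAtMost : ℚ → TaggedPartition → Set
MeshAtMost δ P = ∀ i → i ℕ.< size → point (suc i) -ᴿ point i ≤ᴿ fromℚ δ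
  where open TaggedPartition P

riemannSum : (ℂ → ℂ) → ℂ → TaggedPartition → ℂ
riemannSum f x P = ∑< size (λ i → f (γ (tag i)) * (γ (point (suc i)) - γ (point i)))
  where
  open TaggedPartition P
  γ : ℝ → ℂ
  γ s = ofℝ s * x

-- ∫₀ˣ f(t) dt exists along the segment and equals I
HasSegmentIntegral : (ℂ → ℂ) → ℂ → ℂ → Set
HasSegmentIntegral f x I =
  ∀ ε → 0ℚ Q.< ε → ∃[ δ ] (0ℚ Q.< δ × (∀ P → MeshAtMost δ P → ∣ riemannSum f x P - I ∣≤ ε))

------------------------------------------------------------------------
-- Exponential polynomials and power sums

stirling₂ : ℕ → ℕ → ℕ
stirling₂ zero    zero    = 1
stirling₂ zero    (suc k) = 0
stirling₂ (suc m) zero    = 0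
stirling₂ (suc m) (suc k) = suc k ℕ.* stirling₂ m (suc k) ℕ.+ stirling₂ m k

φ : ℕ → ℂ → ℂ
φ m x = ∑< (suc m) (λ k → ofℕ (stirling₂ m k) * x ^ k)

-- powerSum p n = 1ᵖ + 2ᵖ + ⋯ + nᵖ
powerSum : ℕ → ℕ → ℕ
powerSum p zero    = 0
powerSum p (suc n) = powerSum p n ℕ.+ suc n ℕ.^ p

{-# OPTIONS --safe #-}
module Submission where

-- Write e(n) = xⁿ / n! and n^(j) = n (n - 1) ⋯ (n - j + 1).  Summing
-- nᵖ = ∑ⱼ S(p,j) n^(j) over n gives
--   1ᵖ + ⋯ + nᵖ = ∑ⱼ S(p,j) (n^(j) + n^(j+1) / (j + 1)),
-- and since n^(j) e(n) = xʲ e(n - j), the series ∑ₙ n^(j) e(n) converges to xʲ eˣ.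
--
-- For the integral, (m + 1) cᵐ (b - a) differs from bᵐ⁺¹ - aᵐ⁺¹ by O(μ |b - a|)
-- as soon as c is within μ of a and b; the differences bᵐ⁺¹ - aᵐ⁺¹ telescope.
--
-- All algebra takes place in ℚ(i), at one index k of the approximating sequences.

open import Defs
open import Algebra.Bundles using (CommutativeRing)
import Algebra.Properties.Semiring.Exp as SemiringExp
import Algebra.Solver.Ring as RingSolver
open import Algebra.Solver.Ring.AlmostCommutativeRing
  using (fromCommutativeRing; _-Raw-AlmostCommutative⟶_)
open import Algebra.Structures using (IsCommutativeRing)
open import Data.Integer.Base using (+_)
import Data.Maybe.Base as Maybe
open import Data.Nat.Base as ℕ using (ℕ; zero; suc; NonZero; _!; _⊔_)
import Data.Nat.Properties as ℕₚ
import Data.Nat.Solver as ℕ-Solver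
open import Data.Product.Base using (_×_; _,_; proj₁; proj₂; ∃-syntax)
open import Data.Rational.Base as ℚ using (ℚ; 0ℚ; 1ℚ)
import Data.Rational.Properties as ℚₚ
open import Data.Rational.Solver using (module +-*-Solver)
open import Data.Sum.Base using (inj₁; inj₂)
open import Level using (0ℓ)
open import Relation.Binary.PropositionalEquality
  using (_≡_; refl; sym; trans; cong; cong₂; subst; module ≡-Reasoning; isEquivalence)
open import Relation.Nullary.Decidable using (dec⇒maybe)

open Rational
open RealLemmas using (left; right; rescale; scale-pos)
open ℝ
open ℂ
open +-*-Solver using ()
  renaming (solve to ℚ-solve; _:=_ to _≔_; _:+_ to _⊞_; _:*_ to _⊛_; _:-_ to _⊟_; :-_ to ⊟_; con to ℚ-con)

-- Convergence in the statement compares complex numbers, that is, their approximations at all large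
-- indices k. The limit notion `_⇝_` below fixes the stage first (a number of terms, or a partition)
-- and lets k grow afterwards, and the integral depends on this order. At a single index the
-- inequalities of a tagged partition hold only up to an error η, so the points read there may run
-- backwards, and the errors of n pieces accumulate. Since the partition is known before k, η can be
-- chosen as δ / (n + 1), and the accumulated error stays below a fixed multiple of δ.
--
-- The reading at one index also settles the last equation of the theorem: both of its sides are
-- built from the same sequences for x and `exp x`, so a ring identity at each k is enough.

infix  8 ⊝_
infixl 7 _⊗_
infixl 6 _⊕_ _⊖_

-- Gaussian rationals.  They are opaque because the approximations of complex
-- numbers, once unfolded, make conversion checking infeasible.
opaque

  𝔾 : Set
  𝔾 = ℚ × ℚ

  _⊕_ _⊗_ : 𝔾 → 𝔾 → 𝔾
  (a , b) ⊕ (c , d) = a ℚ.+ c , b ℚ.+ d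
  (a , b) ⊗ (c , d) = a ℚ.* c ℚ.- b ℚ.* d , a ℚ.* d ℚ.+ b ℚ.* c

  ⊝_ : 𝔾 → 𝔾
  ⊝ (a , b) = ℚ.- a , ℚ.- b

  ι : ℚ → 𝔾
  ι q = q , 0ℚ

  ⊕-⊗-isCommutativeRing : IsCommutativeRing _≡_ _⊕_ _⊗_ ⊝_ (ι 0ℚ) (ι 1ℚ)
  ⊕-⊗-isCommutativeRing = record
    { isRing = record
      { +-isAbelianGroup = record
        { isGroup = record
          { isMonoid = record
            { isSemigroup = record
              { isMagma = record { isEquivalence = isEquivalence ; ∙-cong = cong₂ _⊕_ }
              ; assoc = λ (a , b) (c , d) (e , f) → cong₂ _,_ (ℚₚ.+-assoc a c e) (ℚₚ.+-assoc b d f)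
              }
            ; identity = (λ (a , b) → cong₂ _,_ (ℚₚ.+-identityˡ a) (ℚₚ.+-identityˡ b))
                       , (λ (a , b) → cong₂ _,_ (ℚₚ.+-identityʳ a) (ℚₚ.+-identityʳ b))
            }
          ; inverse = (λ (a , b) → cong₂ _,_ (ℚₚ.+-inverseˡ a) (ℚₚ.+-inverseˡ b))
                    , (λ (a , b) → cong₂ _,_ (ℚₚ.+-inverseʳ a) (ℚₚ.+-inverseʳ b))
          ; ⁻¹-cong = cong ⊝_
          }
        ; comm = λ (a , b) (c , d) → cong₂ _,_ (ℚₚ.+-comm a c) (ℚₚ.+-comm b d)
        }
      ; *-cong = cong₂ _⊗_
      ; *-assoc = λ (a , b) (c , d) (e , f) → cong₂ _,_
          (ℚ-solve 6 (λ a b c d e f →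
            (a ⊛ c ⊟ b ⊛ d) ⊛ e ⊟ (a ⊛ d ⊞ b ⊛ c) ⊛ f
              ≔ a ⊛ (c ⊛ e ⊟ d ⊛ f) ⊟ b ⊛ (c ⊛ f ⊞ d ⊛ e)) refl a b c d e f)
          (ℚ-solve 6 (λ a b c d e f →
            (a ⊛ c ⊟ b ⊛ d) ⊛ f ⊞ (a ⊛ d ⊞ b ⊛ c) ⊛ e
              ≔ a ⊛ (c ⊛ f ⊞ d ⊛ e) ⊞ b ⊛ (c ⊛ e ⊟ d ⊛ f)) refl a b c d e f)
      ; *-identity =
          (λ (a , b) → cong₂ _,_
            (ℚ-solve 2 (λ a b → ℚ-con 1ℚ ⊛ a ⊟ ℚ-con 0ℚ ⊛ b ≔ a) refl a b)
            (ℚ-solve 2 (λ a b → ℚ-con 1ℚ ⊛ b ⊞ ℚ-con 0ℚ ⊛ a ≔ b) refl a b))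
        , (λ (a , b) → cong₂ _,_
            (ℚ-solve 2 (λ a b → a ⊛ ℚ-con 1ℚ ⊟ b ⊛ ℚ-con 0ℚ ≔ a) refl a b)
            (ℚ-solve 2 (λ a b → a ⊛ ℚ-con 0ℚ ⊞ b ⊛ ℚ-con 1ℚ ≔ b) refl a b))
      ; distrib =
          (λ (a , b) (c , d) (e , f) → cong₂ _,_
            (ℚ-solve 6 (λ a b c d e f →
              a ⊛ (c ⊞ e) ⊟ b ⊛ (d ⊞ f) ≔ (a ⊛ c ⊟ b ⊛ d) ⊞ (a ⊛ e ⊟ b ⊛ f))
              refl a b c d e f)
            (ℚ-solve 6 (λ a b c d e f →
              a ⊛ (d ⊞ f) ⊞ b ⊛ (c ⊞ e) ≔ (a ⊛ d ⊞ b ⊛ c) ⊞ (a ⊛ f ⊞ b ⊛ e))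
              refl a b c d e f))
        , (λ (a , b) (c , d) (e , f) → cong₂ _,_
            (ℚ-solve 6 (λ a b c d e f →
              (c ⊞ e) ⊛ a ⊟ (d ⊞ f) ⊛ b ≔ (c ⊛ a ⊟ d ⊛ b) ⊞ (e ⊛ a ⊟ f ⊛ b))
              refl a b c d e f)
            (ℚ-solve 6 (λ a b c d e f →
              (c ⊞ e) ⊛ b ⊞ (d ⊞ f) ⊛ a ≔ (c ⊛ b ⊞ d ⊛ a) ⊞ (e ⊛ b ⊞ f ⊛ a))
              refl a b c d e f))
      }
    ; *-comm = λ (a , b) (c , d) → cong₂ _,_
        (ℚ-solve 4 (λ a b c d → a ⊛ c ⊟ b ⊛ d ≔ c ⊛ a ⊟ d ⊛ b) refl a b c d)
        (ℚ-solve 4 (λ a b c d → a ⊛ d ⊞ b ⊛ c ≔ c ⊛ b ⊞ d ⊛ a) refl a b c d)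
    }

  ι-+ : ∀ p q → ι (p ℚ.+ q) ≡ ι p ⊕ ι q
  ι-+ p q = cong₂ _,_ refl (sym (ℚₚ.+-identityˡ 0ℚ))

  ι-* : ∀ p q → ι (p ℚ.* q) ≡ ι p ⊗ ι q
  ι-* p q = cong₂ _,_
    (ℚ-solve 2 (λ p q → p ⊛ q ≔ p ⊛ q ⊟ ℚ-con 0ℚ ⊛ ℚ-con 0ℚ) refl p q)
    (ℚ-solve 2 (λ p q → ℚ-con 0ℚ ≔ p ⊛ ℚ-con 0ℚ ⊞ ℚ-con 0ℚ ⊛ q) refl p q)

  ι-neg : ∀ p → ι (ℚ.- p) ≡ ⊝ ι p
  ι-neg p = refl

_⊖_ : 𝔾 → 𝔾 → 𝔾
z ⊖ w = z ⊕ ⊝ w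

⊕-⊗-commutativeRing : CommutativeRing 0ℓ 0ℓ
⊕-⊗-commutativeRing = record { isCommutativeRing = ⊕-⊗-isCommutativeRing }

-- Lets the ring solver for `𝔾` take its coefficients in ℚ, where equality is decidable, so that
-- rational constants may occur in the identities.
ι-homomorphism : CommutativeRing.rawRing ℚₚ.+-*-commutativeRing
                   -Raw-AlmostCommutative⟶ fromCommutativeRing ⊕-⊗-commutativeRing
ι-homomorphism = record
  { ⟦_⟧ = ι ; +-homo = ι-+ ; *-homo = ι-* ; -‿homo = ι-neg ; 0-homo = refl ; 1-homo = refl }

module 𝔾-Solver = RingSolver _ (fromCommutativeRing ⊕-⊗-commutativeRing) ι-homomorphism
  (λ p q → Maybe.map (cong ι) (dec⇒maybe (p ℚₚ.≟ q)))

module 𝔾ₚ = CommutativeRing ⊕-⊗-commutativeRing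

open SemiringExp 𝔾ₚ.semiring using () renaming (_^_ to _↑_)

-- The 1-norm, and complex numbers read at an index

opaque
  unfolding 𝔾

  infix 9 ∥_∥

  -- The 1-norm replaces the modulus: it has rational values, is submultiplicative, and dominates
  -- the modulus, so a bound in it implies the squared bound of `∣_∣≤_`.
  ∥_∥ : 𝔾 → ℚ
  ∥ a , b ∥ = ℚ.∣ a ∣ ℚ.+ ℚ.∣ b ∣

  ∥∥-nonneg : ∀ z → 0ℚ ℚ.≤ ∥ z ∥
  ∥∥-nonneg (a , b) = ℚₚ.≤-trans (ℚₚ.≤-reflexive (sym (ℚₚ.+-identityˡ 0ℚ)))
    (ℚₚ.+-mono-≤ (ℚₚ.0≤∣p∣ a) (ℚₚ.0≤∣p∣ b))

  ∥⊕∥≤ : ∀ z w → ∥ z ⊕ w ∥ ℚ.≤ ∥ z ∥ ℚ.+ ∥ w ∥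
  ∥⊕∥≤ (a , b) (c , d) = subst (∥ (a , b) ⊕ (c , d) ∥ ℚ.≤_)
    (ℚ-solve 4 (λ a b c d → (a ⊞ c) ⊞ (b ⊞ d) ≔ (a ⊞ b) ⊞ (c ⊞ d)) refl
      (ℚ.∣ a ∣) (ℚ.∣ b ∣) (ℚ.∣ c ∣) (ℚ.∣ d ∣))
    (ℚₚ.+-mono-≤ (ℚₚ.∣p+q∣≤∣p∣+∣q∣ a c) (ℚₚ.∣p+q∣≤∣p∣+∣q∣ b d))

  ∥⊝∥ : ∀ z → ∥ ⊝ z ∥ ≡ ∥ z ∥
  ∥⊝∥ (a , b) = cong₂ ℚ._+_ (ℚₚ.∣-p∣≡∣p∣ a) (ℚₚ.∣-p∣≡∣p∣ b)

  ∥ι∥ : ∀ q → ∥ ι q ∥ ≡ ℚ.∣ q ∣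
  ∥ι∥ q = ℚₚ.+-identityʳ ℚ.∣ q ∣

  -- The operations of ℂ act index by index, so `ev k` commutes with them by definition; this is why
  -- the equations for it hold by `refl`.
  ev : ℕ → ℂ → 𝔾
  ev k z = seq (re z) k , seq (im z) k

  ∥⊗∥≤ : ∀ z w → ∥ z ⊗ w ∥ ℚ.≤ ∥ z ∥ ℚ.* ∥ w ∥
  -- A pair of rationals is the value at index 0 of a complex number with constant sequences, for
  -- which the inequality is already available.
  ∥⊗∥≤ (a , b) (c , d) = Norm.‖-‖-* (fromℚ a +i fromℚ b) (fromℚ c +i fromℚ d) 0

  ev-+ : ∀ k z w → ev k (z + w) ≡ ev k z ⊕ ev k w
  ev-+ k z w = refl

  ev-* : ∀ k z w → ev k (z * w) ≡ ev k z ⊗ ev k w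
  ev-* k z w = refl

  ev-- : ∀ k z w → ev k (z - w) ≡ ev k z ⊖ ev k w
  ev-- k z w = refl

  ev-ofℚ : ∀ k q → ev k (ofℚ q) ≡ ι q
  ev-ofℚ k q = refl

  ∥ev∥ : ∀ k z → ∥ ev k z ∥ ≡ Norm.‖ z ‖ k
  ∥ev∥ k z = refl

  ev-injective : ∀ {z w} → (∀ k → ev k z ≡ ev k w) → z ≈ w
  ev-injective {z} {w} eq =
    close (re z) (re w) (λ k → cong proj₁ (eq k)) , close (im z) (im w) (λ k → cong proj₂ (eq k))
    where
    close : ∀ x y → (∀ k → seq x k ≡ seq y k) → x ≈ᴿ y
    close x y eq ε 0<ε = 0 , λ k _ →
      subst (ℚ._≤ ε)
        (sym (cong ℚ.∣_∣ (trans (cong (ℚ._- seq y k) (eq k)) (ℚₚ.+-inverseʳ (seq y k)))))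
        (ℚₚ.<⇒≤ 0<ε)

  ∥∥≤⇒∣∣≤ : ∀ z ε → Eventually (λ k → ∥ ev k z ∥ ℚ.≤ ε) → ∣ z ∣≤ ε
  ∥∥≤⇒∣∣≤ z ε (N , small) η 0<η = N , λ k N≤k →
    ℚₚ.≤-trans
      -- `square-sum` speaks of rationals only; `0ℂ` with its bound merely instantiates the module
      -- that contains it.
      (let K , k₀ , ‖0‖≤K = Norm.‖-‖-bounded 0ℂ
       in Majorant.square-sum 0ℂ K k₀ ‖0‖≤K (seq (re z) k) (seq (im z) k) ε (small k N≤k))
      (subst (ℚ._≤ ε ℚ.* ε ℚ.+ η) (ℚₚ.+-identityʳ (ε ℚ.* ε)) (ℚₚ.+-monoʳ-≤ (ε ℚ.* ε) (ℚₚ.<⇒≤ 0<η)))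

  -- By the diagonal construction, `exp x` at index k is the k-th partial sum read at k. For n, k ≥
  -- M both the n-th and the k-th partial sum are within ε/2 of the M-th.
  ev-exp : ∀ x ε → 0ℚ ℚ.< ε → ∃[ N ] (∀ n → N ℕ.≤ n →
           Eventually (λ k → ∥ ev k (∑< n (expTerm x)) ⊖ ev k (exp x) ∥ ℚ.≤ ε))
  ev-exp x ε 0<ε =
    let K , k₀ , h = Norm.‖-‖-bounded x
        open Majorant x K k₀ h
        M , close = tail (half ε) (half-pos 0<ε)
    in M , λ n M≤n → M ⊔ k₀ , λ k hk →
         ℚₚ.≤-trans (dist-triangle (partial n) (partial M) (partial k) k)
           (subst (Norm.dist (partial n) (partial M) k ℚ.+ Norm.dist (partial k) (partial M) k ℚ.≤_)
             (half+half ε)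
             (ℚₚ.+-mono-≤ (close n k M≤n (right {M} hk)) (close k k (left hk) (right {M} hk))))

open 𝔾-Solver using (solve; _:=_; _:+_; _:*_; _:-_; :-_; con)

-- Finite sums and falling factorials

∑ : ℕ → (ℕ → 𝔾) → 𝔾
∑ zero    f = ι 0ℚ
∑ (suc n) f = ∑ n f ⊕ f n

∑-cong : ∀ n {f g} → (∀ i → f i ≡ g i) → ∑ n f ≡ ∑ n g
∑-cong zero    eq = refl
∑-cong (suc n) eq = cong₂ _⊕_ (∑-cong n eq) (eq n)

∑-⊕ : ∀ n f g → ∑ n (λ i → f i ⊕ g i) ≡ ∑ n f ⊕ ∑ n g
∑-⊕ zero    f g = sym (𝔾ₚ.+-identityˡ (ι 0ℚ))
∑-⊕ (suc n) f g = trans (cong (_⊕ (f n ⊕ g n)) (∑-⊕ n f g))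
  (solve 4 (λ a b c d → (a :+ b) :+ (c :+ d) := (a :+ c) :+ (b :+ d)) refl (∑ n f) (∑ n g) (f n) (g n))

∑-⊗ : ∀ n c f → ∑ n (λ i → c ⊗ f i) ≡ c ⊗ ∑ n f
∑-⊗ zero    c f = sym (𝔾ₚ.zeroʳ c)
∑-⊗ (suc n) c f = trans (cong (_⊕ (c ⊗ f n)) (∑-⊗ n c f)) (sym (𝔾ₚ.distribˡ c (∑ n f) (f n)))

∑-head : ∀ n f → ∑ (suc n) f ≡ f 0 ⊕ ∑ n (λ i → f (suc i))
∑-head zero    f = 𝔾ₚ.+-comm (ι 0ℚ) (f 0)
∑-head (suc n) f = trans (cong (_⊕ f (suc n)) (∑-head n f)) (𝔾ₚ.+-assoc (f 0) _ (f (suc n)))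

∑-zero : ∀ n → ∑ n (λ _ → ι 0ℚ) ≡ ι 0ℚ
∑-zero zero    = refl
∑-zero (suc n) = trans (𝔾ₚ.+-identityʳ _) (∑-zero n)

∑-swap : ∀ m n (f : ℕ → ℕ → 𝔾) → ∑ m (λ i → ∑ n (f i)) ≡ ∑ n (λ j → ∑ m (λ i → f i j))
∑-swap zero    n f = sym (∑-zero n)
∑-swap (suc m) n f = trans (cong (_⊕ ∑ n (f m)) (∑-swap m n f)) (sym (∑-⊕ n _ (f m)))

ν : ℕ → 𝔾
ν n = ι (nat n)

ν-+ : ∀ m n → ν (m ℕ.+ n) ≡ ν m ⊕ ν n
ν-+ m n = trans (cong ι (nat-+ m n)) (ι-+ (nat m) (nat n))

ν-* : ∀ m n → ν (m ℕ.* n) ≡ ν m ⊗ ν n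
ν-* m n = trans (cong ι (sym (frac-* m 1 n 1))) (ι-* (nat m) (nat n))

recip : ℕ → 𝔾
recip n = ι (+ 1 ℚ./ suc n)

ν-recip : ∀ n → ν (suc n) ⊗ recip n ≡ ι 1ℚ
ν-recip n = trans (sym (ι-* (nat (suc n)) (+ 1 ℚ./ suc n))) (cong ι (inverse n))

term : 𝔾 → ℕ → 𝔾
term x n = ι ((+ 1 ℚ./ n !) {{n ℕₚ.!≢0}}) ⊗ x ↑ n

term-suc : ∀ x n → ν (suc n) ⊗ term x (suc n) ≡ x ⊗ term x n
term-suc x n = begin
  ν (suc n) ⊗ (ι (+ 1 ℚ./ suc n !) ⊗ (x ⊗ x ↑ n))
    ≡⟨ cong (λ c → ν (suc n) ⊗ (c ⊗ (x ⊗ x ↑ n)))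
         (trans (cong ι (sym (frac-* 1 (suc n) 1 (n !)))) (ι-* (+ 1 ℚ./ suc n) (+ 1 ℚ./ n !))) ⟩
  ν (suc n) ⊗ (recip n ⊗ ι (+ 1 ℚ./ n !) ⊗ (x ⊗ x ↑ n))
    ≡⟨ solve 5 (λ a b c d e → a :* (b :* c :* (d :* e)) := (a :* b) :* (d :* (c :* e))) refl
         (ν (suc n)) (recip n) (ι (+ 1 ℚ./ n !)) x (x ↑ n) ⟩
  (ν (suc n) ⊗ recip n) ⊗ (x ⊗ term x n)
    ≡⟨ cong (_⊗ (x ⊗ term x n)) (ν-recip n) ⟩
  ι 1ℚ ⊗ (x ⊗ term x n)
    ≡⟨ 𝔾ₚ.*-identityˡ _ ⟩
  x ⊗ term x n ∎
  where
  open ≡-Reasoning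
  instance
    _ = n ℕₚ.!≢0
    _ = suc n ℕₚ.!≢0

-- Splitting off the largest factor makes (n + 1)^(j+1) = (n + 1) n^(j) definitional, the form in
-- which n + 1 cancels against the factorial.
fall : ℕ → ℕ → ℕ
fall n       zero    = 1
fall zero    (suc j) = 0
fall (suc n) (suc j) = suc n ℕ.* fall n j

-- This is n = (n - j) + j multiplied by n^(j), written without truncated subtraction.
*-fall : ∀ n j → n ℕ.* fall n j ≡ fall n (suc j) ℕ.+ j ℕ.* fall n j
*-fall zero    zero    = refl
*-fall zero    (suc j) = sym (ℕₚ.*-zeroʳ j)
*-fall (suc n) zero    = sym (ℕₚ.+-identityʳ _)
*-fall (suc n) (suc j) = begin
  suc n ℕ.* (F ℕ.+ n ℕ.* F)                            ≡⟨ cong (λ m → suc n ℕ.* (F ℕ.+ m)) (*-fall n j) ⟩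
  suc n ℕ.* (F ℕ.+ (fall n (suc j) ℕ.+ j ℕ.* F))       ≡⟨ ℕ-solve 4 (λ m f g j →
                                                             m *′ (f +′ (g +′ j *′ f)) =′ m *′ g +′ (m *′ f +′ j *′ (m *′ f)))
                                                             refl (suc n) F (fall n (suc j)) j ⟩
  suc n ℕ.* fall n (suc j) ℕ.+ suc j ℕ.* (suc n ℕ.* F) ∎
  where
  open ≡-Reasoning
  open ℕ-Solver.+-*-Solver using () renaming (solve to ℕ-solve; _:+_ to _+′_; _:*_ to _*′_; _:=_ to _=′_)
  F = fall n j

-- The discrete derivative of n^(j+1) is (j + 1) n^(j).
fall-suc : ∀ n j → fall (suc n) (suc j) ≡ fall n (suc j) ℕ.+ suc j ℕ.* fall n j
fall-suc n j = begin
  F ℕ.+ n ℕ.* F                              ≡⟨ cong (F ℕ.+_) (*-fall n j) ⟩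
  F ℕ.+ (fall n (suc j) ℕ.+ j ℕ.* F)         ≡⟨ ℕ-solve 3 (λ f g h → f +′ (g +′ h) =′ g +′ (f +′ h))
                                                  refl F (fall n (suc j)) (j ℕ.* F) ⟩
  fall n (suc j) ℕ.+ (F ℕ.+ j ℕ.* F)         ∎
  where
  open ≡-Reasoning
  open ℕ-Solver.+-*-Solver using () renaming (solve to ℕ-solve; _:+_ to _+′_; _:=_ to _=′_)
  F = fall n j

-- The slack d carries the induction: the recurrence refers to two columns of row m, whose slacks
-- are d + 1 and d.
stirling₂-> : ∀ m d → stirling₂ m (suc (m ℕ.+ d)) ≡ 0
stirling₂-> zero    d = refl
stirling₂-> (suc m) d = begin
  k ℕ.* stirling₂ m k ℕ.+ stirling₂ m (suc (m ℕ.+ d))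
    ≡⟨ cong₂ ℕ._+_ (cong (λ i → k ℕ.* stirling₂ m (suc i)) (sym (ℕₚ.+-suc m d))) (stirling₂-> m d) ⟩
  k ℕ.* stirling₂ m (suc (m ℕ.+ suc d)) ℕ.+ 0
    ≡⟨ cong (λ s → k ℕ.* s ℕ.+ 0) (stirling₂-> m (suc d)) ⟩
  k ℕ.* 0 ℕ.+ 0
    ≡⟨ cong (ℕ._+ 0) (ℕₚ.*-zeroʳ k) ⟩
  0 ∎
  where
  open ≡-Reasoning
  k = suc (suc (m ℕ.+ d))

-- Multiplying the identity for p by n splits its j-th term, by `*-fall`, into `b j` = j S(p,j)
-- n^(j) and `a j` = S(p,j) n^(j+1). After shifting b by one, both are multiples of n^(j+1), and the
-- Stirling recurrence adds their coefficients. The shift loses nothing because b vanishes at 0 and,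
-- as S(p,p+1) = 0, at p + 1.
power-fall : ∀ p n → ν (n ℕ.^ p) ≡ ∑ (suc p) (λ j → ν (stirling₂ p j) ⊗ ν (fall n j))
power-fall zero    n = solve 0 (con 1ℚ := con 0ℚ :+ con 1ℚ :* con 1ℚ) refl
power-fall (suc p) n = begin
  ν (n ℕ.* n ℕ.^ p)                           ≡⟨ ν-* n (n ℕ.^ p) ⟩
  ν n ⊗ ν (n ℕ.^ p)                           ≡⟨ cong (ν n ⊗_) (power-fall p n) ⟩
  ν n ⊗ ∑ (suc p) (λ j → ν (S j) ⊗ ν (F j))   ≡⟨ ∑-⊗ (suc p) (ν n) _ ⟨
  ∑ (suc p) (λ j → ν n ⊗ (ν (S j) ⊗ ν (F j))) ≡⟨ ∑-cong (suc p) split ⟩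
  ∑ (suc p) (λ j → b j ⊕ a j)                 ≡⟨ ∑-⊕ (suc p) b a ⟩
  ∑ (suc p) b ⊕ ∑ (suc p) a                   ≡⟨ cong (_⊕ ∑ (suc p) a) shift ⟩
  ∑ (suc p) (λ j → b (suc j)) ⊕ ∑ (suc p) a   ≡⟨ ∑-⊕ (suc p) _ a ⟨
  ∑ (suc p) (λ j → b (suc j) ⊕ a j)           ≡⟨ ∑-cong (suc p) merge ⟩
  ∑ (suc p) (λ j → c (suc j))                 ≡⟨ 𝔾ₚ.+-identityˡ _ ⟨
  ι 0ℚ ⊕ ∑ (suc p) (λ j → c (suc j))          ≡⟨ cong (_⊕ ∑ (suc p) (λ j → c (suc j))) (𝔾ₚ.zeroˡ (ν (F 0))) ⟨
  c 0 ⊕ ∑ (suc p) (λ j → c (suc j))           ≡⟨ ∑-head (suc p) c ⟨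
  ∑ (suc (suc p)) c                           ∎
  where
  open ≡-Reasoning
  S = stirling₂ p
  F = fall n
  a b c : ℕ → 𝔾
  a j = ν (S j) ⊗ ν (F (suc j))
  b j = ν (j ℕ.* S j) ⊗ ν (F j)
  c j = ν (stirling₂ (suc p) j) ⊗ ν (F j)

  split : ∀ j → ν n ⊗ (ν (S j) ⊗ ν (F j)) ≡ b j ⊕ a j
  split j = begin
    ν n ⊗ (ν (S j) ⊗ ν (F j))
      ≡⟨ solve 3 (λ n s f → n :* (s :* f) := s :* (n :* f)) refl (ν n) (ν (S j)) (ν (F j)) ⟩
    ν (S j) ⊗ (ν n ⊗ ν (F j))
      ≡⟨ cong (ν (S j) ⊗_) (trans (sym (ν-* n (F j))) (trans (cong ν (*-fall n j))
           (trans (ν-+ (F (suc j)) (j ℕ.* F j)) (cong (ν (F (suc j)) ⊕_) (ν-* j (F j)))))) ⟩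
    ν (S j) ⊗ (ν (F (suc j)) ⊕ ν j ⊗ ν (F j))
      ≡⟨ solve 4 (λ s g j f → s :* (g :+ j :* f) := (j :* s) :* f :+ s :* g) refl
           (ν (S j)) (ν (F (suc j))) (ν j) (ν (F j)) ⟩
    (ν j ⊗ ν (S j)) ⊗ ν (F j) ⊕ a j
      ≡⟨ cong (λ s → s ⊗ ν (F j) ⊕ a j) (ν-* j (S j)) ⟨
    b j ⊕ a j ∎

  merge : ∀ j → b (suc j) ⊕ a j ≡ c (suc j)
  merge j = trans (sym (𝔾ₚ.distribʳ (ν (F (suc j))) (ν (suc j ℕ.* S (suc j))) (ν (S j))))
    (cong (_⊗ ν (F (suc j))) (sym (ν-+ (suc j ℕ.* S (suc j)) (S j))))

  b-last : b (suc p) ≡ ι 0ℚ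
  b-last = trans
    (cong (λ s → ν s ⊗ ν (F (suc p)))
      (trans (cong (suc p ℕ.*_) (subst (λ i → S (suc i) ≡ 0) (ℕₚ.+-identityʳ p) (stirling₂-> p 0)))
             (ℕₚ.*-zeroʳ (suc p))))
    (𝔾ₚ.zeroˡ (ν (F (suc p))))

  shift : ∑ (suc p) b ≡ ∑ (suc p) (λ j → b (suc j))
  shift = begin
    ∑ (suc p) b                           ≡⟨ 𝔾ₚ.+-identityʳ _ ⟨
    ∑ (suc p) b ⊕ ι 0ℚ                    ≡⟨ cong (∑ (suc p) b ⊕_) b-last ⟨
    ∑ (suc (suc p)) b                     ≡⟨ ∑-head (suc p) b ⟩
    b 0 ⊕ ∑ (suc p) (λ j → b (suc j))     ≡⟨ cong (_⊕ ∑ (suc p) (λ j → b (suc j))) (𝔾ₚ.zeroˡ (ν (F 0))) ⟩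
    ι 0ℚ ⊕ ∑ (suc p) (λ j → b (suc j))    ≡⟨ 𝔾ₚ.+-identityˡ _ ⟩
    ∑ (suc p) (λ j → b (suc j))           ∎

-- fallSum n j = ∑ᵢ₌₀ⁿ fall i j, i.e. fall (suc n) (suc j) / (j + 1)
fallSum : ℕ → ℕ → 𝔾
fallSum n j = ν (fall n j) ⊕ recip j ⊗ ν (fall n (suc j))

fallSum-zero : ∀ j → fallSum 0 j ≡ ν (fall 0 j)
fallSum-zero j = trans (cong (ν (fall 0 j) ⊕_) (𝔾ₚ.zeroʳ (recip j))) (𝔾ₚ.+-identityʳ _)

-- By `fall-suc`, (n + 1)^(j+1) / (j + 1) equals n^(j) + n^(j+1) / (j + 1), which is `fallSum n j`
-- itself.
fallSum-suc : ∀ n j → fallSum (suc n) j ≡ fallSum n j ⊕ ν (fall (suc n) j)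
fallSum-suc n j = begin
  f ⊕ recip j ⊗ ν (fall (suc n) (suc j))
    ≡⟨ cong (λ s → f ⊕ recip j ⊗ s) (trans (cong ν (fall-suc n j))
         (trans (ν-+ (fall n (suc j)) (suc j ℕ.* fall n j))
                (cong (ν (fall n (suc j)) ⊕_) (ν-* (suc j) (fall n j))))) ⟩
  f ⊕ recip j ⊗ (h ⊕ ν (suc j) ⊗ g)
    ≡⟨ solve 5 (λ f r h s g → f :+ r :* (h :+ s :* g) := ((s :* r) :* g :+ r :* h) :+ f) refl
         f (recip j) h (ν (suc j)) g ⟩
  ((ν (suc j) ⊗ recip j) ⊗ g ⊕ recip j ⊗ h) ⊕ f
    ≡⟨ cong (λ s → (s ⊕ recip j ⊗ h) ⊕ f) (trans (cong (_⊗ g) (ν-recip j)) (𝔾ₚ.*-identityˡ g)) ⟩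
  (g ⊕ recip j ⊗ h) ⊕ f ∎
  where
  open ≡-Reasoning
  f = ν (fall (suc n) j)
  g = ν (fall n j)
  h = ν (fall n (suc j))

powerSum-fallSum : ∀ p n → ν (powerSum (suc p) n) ≡ ∑ (suc (suc p)) (λ j → ν (stirling₂ (suc p) j) ⊗ fallSum n j)
-- `fallSum` starts at i = 0 while the power sum starts at 1. The extra term is 0 raised to the
-- exponent `suc p`, hence 0: the positivity of the exponent enters here.
powerSum-fallSum p zero    = trans (power-fall (suc p) 0)
  (∑-cong (suc (suc p)) (λ j → cong (ν (stirling₂ (suc p) j) ⊗_) (sym (fallSum-zero j))))
powerSum-fallSum p (suc n) = begin
  ν (powerSum (suc p) n ℕ.+ suc n ℕ.^ suc p)
    ≡⟨ ν-+ (powerSum (suc p) n) (suc n ℕ.^ suc p) ⟩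
  ν (powerSum (suc p) n) ⊕ ν (suc n ℕ.^ suc p)
    ≡⟨ cong₂ _⊕_ (powerSum-fallSum p n) (power-fall (suc p) (suc n)) ⟩
  ∑ (suc (suc p)) (λ j → S j ⊗ fallSum n j) ⊕ ∑ (suc (suc p)) (λ j → S j ⊗ ν (fall (suc n) j))
    ≡⟨ ∑-⊕ (suc (suc p)) _ _ ⟨
  ∑ (suc (suc p)) (λ j → S j ⊗ fallSum n j ⊕ S j ⊗ ν (fall (suc n) j))
    ≡⟨ ∑-cong (suc (suc p)) (λ j → trans (sym (𝔾ₚ.distribˡ (S j) (fallSum n j) _))
                                         (cong (S j ⊗_) (sym (fallSum-suc n j)))) ⟩
  ∑ (suc (suc p)) (λ j → S j ⊗ fallSum (suc n) j) ∎
  where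
  open ≡-Reasoning
  S : ℕ → 𝔾
  S j = ν (stirling₂ (suc p) j)

fallTerm : 𝔾 → ℕ → ℕ → 𝔾
fallTerm x j n = ν (fall n j) ⊗ term x n

fallTerm-suc : ∀ x j n → fallTerm x (suc j) (suc n) ≡ x ⊗ fallTerm x j n
fallTerm-suc x j n = begin
  ν (suc n ℕ.* fall n j) ⊗ term x (suc n)
    ≡⟨ cong (_⊗ term x (suc n)) (ν-* (suc n) (fall n j)) ⟩
  (ν (suc n) ⊗ ν (fall n j)) ⊗ term x (suc n)
    ≡⟨ solve 3 (λ a b c → (a :* b) :* c := b :* (a :* c)) refl (ν (suc n)) (ν (fall n j)) (term x (suc n)) ⟩
  ν (fall n j) ⊗ (ν (suc n) ⊗ term x (suc n))
    ≡⟨ cong (ν (fall n j) ⊗_) (term-suc x n) ⟩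
  ν (fall n j) ⊗ (x ⊗ term x n)
    ≡⟨ solve 3 (λ a b c → a :* (b :* c) := b :* (a :* c)) refl (ν (fall n j)) x (term x n) ⟩
  x ⊗ fallTerm x j n ∎
  where open ≡-Reasoning

∑-fallTerm-zero : ∀ x n → ∑ n (fallTerm x 0) ≡ ∑ n (term x)
∑-fallTerm-zero x n = ∑-cong n (λ i → 𝔾ₚ.*-identityˡ (term x i))

∑-fallTerm-suc : ∀ x j n → ∑ (suc n) (fallTerm x (suc j)) ≡ x ⊗ ∑ n (fallTerm x j)
∑-fallTerm-suc x j n = begin
  ∑ (suc n) (fallTerm x (suc j))
    ≡⟨ ∑-head n _ ⟩
  ι 0ℚ ⊗ term x 0 ⊕ ∑ n (λ i → fallTerm x (suc j) (suc i))
    ≡⟨ cong₂ _⊕_ (𝔾ₚ.zeroˡ (term x 0)) (∑-cong n (fallTerm-suc x j)) ⟩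
  ι 0ℚ ⊕ ∑ n (λ i → x ⊗ fallTerm x j i)
    ≡⟨ trans (𝔾ₚ.+-identityˡ _) (∑-⊗ n x _) ⟩
  x ⊗ ∑ n (fallTerm x j) ∎
  where open ≡-Reasoning

powerSum-term : ∀ p x n → ν (powerSum (suc p) n) ⊗ term x n ≡
  ∑ (suc (suc p)) (λ j → ν (stirling₂ (suc p) j) ⊗ (fallTerm x j n ⊕ recip j ⊗ fallTerm x (suc j) n))
powerSum-term p x n = begin
  ν (powerSum (suc p) n) ⊗ term x n
    ≡⟨ cong (_⊗ term x n) (powerSum-fallSum p n) ⟩
  ∑ (suc (suc p)) (λ j → S j ⊗ fallSum n j) ⊗ term x n
    ≡⟨ 𝔾ₚ.*-comm _ (term x n) ⟩
  term x n ⊗ ∑ (suc (suc p)) (λ j → S j ⊗ fallSum n j)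
    ≡⟨ ∑-⊗ (suc (suc p)) (term x n) _ ⟨
  ∑ (suc (suc p)) (λ j → term x n ⊗ (S j ⊗ fallSum n j))
    ≡⟨ ∑-cong (suc (suc p)) (λ j →
         solve 5 (λ t s f r g → t :* (s :* (f :+ r :* g)) := s :* (f :* t :+ r :* (g :* t))) refl
           (term x n) (S j) (ν (fall n j)) (recip j) (ν (fall n (suc j)))) ⟩
  ∑ (suc (suc p)) (λ j → S j ⊗ (fallTerm x j n ⊕ recip j ⊗ fallTerm x (suc j) n)) ∎
  where
  open ≡-Reasoning
  S : ℕ → 𝔾
  S j = ν (stirling₂ (suc p) j)

-- Limits

Eventually-∩ : ∀ {P Q : ℕ → Set} → Eventually P → Eventually Q → Eventually (λ k → P k × Q k)
Eventually-∩ (M , p) (N , q) = M ⊔ N , λ k h → p k (left h) , q k (right {M} h)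

Eventually-map : ∀ {P Q : ℕ → Set} → (∀ k → P k → Q k) → Eventually P → Eventually Q
Eventually-map f (N , p) = N , λ k h → f k (p k h)

-- The bound is a positive natural number so that `rescale` can divide ε by it.
Bounded : (ℕ → 𝔾) → Set
Bounded c = ∃[ B ] Eventually (λ k → ∥ c k ∥ ℚ.≤ nat (suc B))

ev-bounded : ∀ z → Bounded (λ k → ev k z)
ev-bounded z = let B , N , h = Norm.‖-‖-bounded z in B , N , λ k N≤k →
  ℚₚ.≤-trans (ℚₚ.≤-reflexive (∥ev∥ k z))
    (ℚₚ.≤-trans (h k N≤k) (frac-≤ B 1 (suc B) 1 (ℕₚ.*-monoˡ-≤ 1 (ℕₚ.n≤1+n B))))

constant-bounded : ∀ z → Bounded (λ _ → z)
constant-bounded z = let B , h = archimedean ∥ z ∥ in B , 0 , λ _ _ → h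

-- Limits along the filter base F d of subsets of A.  A sequence ℕ → 𝔾 stands
-- for the complex number it approximates.
module Limit {A D : Set} (F : D → A → Set) (d₀ : D)
             (meet : ∀ d e → ∃[ f ] (∀ a → F f a → F d a × F e a)) where

  infix 4 _⇝_

  -- The threshold for k is chosen after a, since the approximations of a partition obey its
  -- inequalities only from an index on that depends on the partition.
  _⇝_ : (A → ℕ → 𝔾) → (ℕ → 𝔾) → Set
  s ⇝ L = ∀ ε → 0ℚ ℚ.< ε →
          ∃[ d ] (∀ a → F d a → Eventually (λ k → ∥ s a k ⊖ L k ∥ ℚ.≤ ε))

  ⇝-resp : ∀ {s t L M} → (∀ a k → s a k ≡ t a k) → (∀ k → L k ≡ M k) → s ⇝ L → t ⇝ M
  ⇝-resp eq eq′ lim ε 0<ε = let d , h = lim ε 0<ε in d , λ a Fa →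
    Eventually-map (λ k → subst (ℚ._≤ ε) (cong₂ (λ u v → ∥ u ⊖ v ∥) (eq a k) (eq′ k))) (h a Fa)

  ⇝-const : ∀ c → (λ _ → c) ⇝ c
  ⇝-const c ε 0<ε = d₀ , λ _ _ → 0 , λ k _ →
    ℚₚ.≤-trans (ℚₚ.≤-reflexive (trans (cong ∥_∥ (𝔾ₚ.-‿inverseʳ (c k))) (∥ι∥ 0ℚ))) (ℚₚ.<⇒≤ 0<ε)

  ⇝-⊕ : ∀ {s t L M} → s ⇝ L → t ⇝ M → (λ a k → s a k ⊕ t a k) ⇝ (λ k → L k ⊕ M k)
  ⇝-⊕ {s} {t} {L} {M} lim lim′ ε 0<ε =
    let d , h  = lim (half ε) (half-pos 0<ε)
        e , h′ = lim′ (half ε) (half-pos 0<ε)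
        f , F⇒ = meet d e
    in f , λ a Ff → Eventually-map
         (λ k (p , q) → begin
           ∥ (s a k ⊕ t a k) ⊖ (L k ⊕ M k) ∥
             ≡⟨ cong ∥_∥ (solve 4 (λ s t l m → (s :+ t) :- (l :+ m) := (s :- l) :+ (t :- m)) refl
                  (s a k) (t a k) (L k) (M k)) ⟩
           ∥ (s a k ⊖ L k) ⊕ (t a k ⊖ M k) ∥         ≤⟨ ∥⊕∥≤ _ _ ⟩
           ∥ s a k ⊖ L k ∥ ℚ.+ ∥ t a k ⊖ M k ∥       ≤⟨ ℚₚ.+-mono-≤ p q ⟩
           half ε ℚ.+ half ε                         ≡⟨ half+half ε ⟩
           ε                                         ∎)
         (Eventually-∩ (h a (proj₁ (F⇒ a Ff))) (h′ a (proj₂ (F⇒ a Ff))))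
    where open ℚₚ.≤-Reasoning

  ⇝-⊗ : ∀ {s L} c → Bounded c → s ⇝ L → (λ a k → c k ⊗ s a k) ⇝ (λ k → c k ⊗ L k)
  ⇝-⊗ {s} {L} c (B , bound) lim ε 0<ε =
    let d , h = lim (ε ℚ.* (+ 1 ℚ./ suc B)) (scale-pos B 0<ε)
    in d , λ a Fa → Eventually-map
         (λ k (p , q) → begin
           ∥ c k ⊗ s a k ⊖ c k ⊗ L k ∥
             ≡⟨ cong ∥_∥ (solve 3 (λ c s l → c :* s :- c :* l := c :* (s :- l)) refl (c k) (s a k) (L k)) ⟩
           ∥ c k ⊗ (s a k ⊖ L k) ∥                   ≤⟨ ∥⊗∥≤ _ _ ⟩
           ∥ c k ∥ ℚ.* ∥ s a k ⊖ L k ∥               ≤⟨ mul-mono (∥∥-nonneg _) (frac-nonneg (suc B) 1) p q ⟩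
           nat (suc B) ℚ.* (ε ℚ.* (+ 1 ℚ./ suc B))   ≡⟨ rescale B ε ⟩
           ε                                         ∎)
         (Eventually-∩ bound (h a Fa))
    where open ℚₚ.≤-Reasoning

  ⇝-∑ : ∀ {s : ℕ → A → ℕ → 𝔾} {L : ℕ → ℕ → 𝔾} n → (∀ j → s j ⇝ L j) →
        (λ a k → ∑ n (λ j → s j a k)) ⇝ (λ k → ∑ n (λ j → L j k))
  ⇝-∑ zero    lim = ⇝-const (λ _ → ι 0ℚ)
  ⇝-∑ (suc n) lim = ⇝-⊕ (⇝-∑ n lim) (lim n)

-- Values of powers, exponential terms and `φ` at an index

ev-∑ : ∀ k n f → ev k (∑< n f) ≡ ∑ n (λ i → ev k (f i))
ev-∑ k zero    f = ev-ofℚ k 0ℚ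
ev-∑ k (suc n) f = trans (ev-+ k (∑< n f) (f n)) (cong (_⊕ ev k (f n)) (ev-∑ k n f))

opaque
  unfolding ev

  ev-1 : ∀ k z → ev k (z ^ 0) ≡ ι 1ℚ
  ev-1 k z = refl

  ev-^-suc : ∀ k z n → ev k (z ^ suc n) ≡ ev k z ⊗ ev k (z ^ n)
  ev-^-suc k z n = refl

  ev-ofℕ-* : ∀ k n z → ev k (ofℕ n * z) ≡ ν n ⊗ ev k z
  ev-ofℕ-* k n z = refl

  ev-expTerm-^ : ∀ k x n → ev k (expTerm x n) ≡ ι ((+ 1 ℚ./ n !) {{n ℕₚ.!≢0}}) ⊗ ev k (x ^ n)
  ev-expTerm-^ k x n = refl

ev-^ : ∀ k z n → ev k (z ^ n) ≡ ev k z ↑ n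
ev-^ k z zero    = ev-1 k z
ev-^ k z (suc n) = trans (ev-^-suc k z n) (cong (ev k z ⊗_) (ev-^ k z n))

ev-expTerm : ∀ k x n → ev k (expTerm x n) ≡ term (ev k x) n
ev-expTerm k x n = trans (ev-expTerm-^ k x n)
  (cong (ι ((+ 1 ℚ./ n !) {{n ℕₚ.!≢0}}) ⊗_) (ev-^ k x n))

ev-φ : ∀ k p z → ev k (φ p z) ≡ ∑ (suc p) (λ j → ν (stirling₂ p j) ⊗ ev k z ↑ j)
ev-φ k p z = trans (ev-∑ k (suc p) (λ j → ofℕ (stirling₂ p j) * z ^ j))
  (∑-cong (suc p) (λ j →
    trans (ev-ofℕ-* k (stirling₂ p j) (z ^ j)) (cong (ν (stirling₂ p j) ⊗_) (ev-^ k z j))))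

-- Convergence of the series

module Sequence where

  open Limit {ℕ} {ℕ} ℕ._≤_ 0 (λ M N → M ⊔ N , λ n h → left h , right {M} h) public

  ⇝-delay : ∀ {s L} → (λ n → s (suc n)) ⇝ L → s ⇝ L
  ⇝-delay lim ε 0<ε = let N , h = lim ε 0<ε in suc N , λ { (suc n) (ℕ.s≤s N≤n) → h n N≤n }

  ⇝-tail : ∀ {s L} → s ⇝ L → (λ n → s (suc n)) ⇝ L
  ⇝-tail lim ε 0<ε = let N , h = lim ε 0<ε in N , λ n N≤n → h (suc n) (ℕₚ.m≤n⇒m≤1+n N≤n)

  ⇝⇒HasSum : ∀ {f S} → (λ n k → ∑ n (λ i → ev k (f i))) ⇝ (λ k → ev k S) → HasSum f S
  ⇝⇒HasSum {f} {S} lim ε 0<ε = let N , h = lim ε 0<ε in N , λ n N≤n →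
    ∥∥≤⇒∣∣≤ (∑< n f - S) ε (Eventually-map
      (λ k → subst (ℚ._≤ ε) (cong ∥_∥ (sym (trans (ev-- k (∑< n f) S) (cong (_⊖ ev k S) (ev-∑ k n f))))))
      (h n N≤n))

  exp-⇝ : ∀ x → (λ n k → ∑ n (term (ev k x))) ⇝ (λ k → ev k (exp x))
  exp-⇝ x = ⇝-resp
    (λ n k → trans (ev-∑ k n (expTerm x)) (∑-cong n (ev-expTerm k x)))
    (λ _ → refl) (ev-exp x)

  -- Induction on j: one more falling factor multiplies the series by x and delays its partial sums
  -- by one term, which `⇝-delay` absorbs.
  fallTerm-⇝ : ∀ x j → (λ n k → ∑ n (fallTerm (ev k x) j)) ⇝ (λ k → ev k x ↑ j ⊗ ev k (exp x))
  fallTerm-⇝ x zero    = ⇝-resp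
    (λ n k → sym (∑-fallTerm-zero (ev k x) n)) (λ k → sym (𝔾ₚ.*-identityˡ _)) (exp-⇝ x)
  fallTerm-⇝ x (suc j) = ⇝-delay (⇝-resp
    (λ n k → sym (∑-fallTerm-suc (ev k x) j n))
    (λ k → sym (𝔾ₚ.*-assoc (ev k x) _ _))
    (⇝-⊗ (λ k → ev k x) (ev-bounded x) (fallTerm-⇝ x j)))

  powerSum-⇝ : ∀ p x →
    (λ n k → ∑ n (λ i → ν (powerSum (suc p) i) ⊗ term (ev k x) i)) ⇝
    (λ k → ∑ (suc (suc p)) (λ j → ν (stirling₂ (suc p) j) ⊗
      (ev k x ↑ j ⊗ ev k (exp x) ⊕ recip j ⊗ (ev k x ↑ suc j ⊗ ev k (exp x)))))
  powerSum-⇝ p x = ⇝-resp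
    (λ n k → sym (begin
      ∑ n (λ i → ν (powerSum (suc p) i) ⊗ term (ev k x) i)
        ≡⟨ ∑-cong n (powerSum-term p (ev k x)) ⟩
      ∑ n (λ i → ∑ (suc (suc p)) (λ j → S j ⊗ (fallTerm (ev k x) j i ⊕ recip j ⊗ fallTerm (ev k x) (suc j) i)))
        ≡⟨ ∑-swap n (suc (suc p)) _ ⟩
      ∑ (suc (suc p)) (λ j → ∑ n (λ i → S j ⊗ (fallTerm (ev k x) j i ⊕ recip j ⊗ fallTerm (ev k x) (suc j) i)))
        ≡⟨ ∑-cong (suc (suc p)) (λ j → trans (∑-⊗ n (S j) _) (cong (S j ⊗_)
             (trans (∑-⊕ n _ _) (cong (∑ n (fallTerm (ev k x) j) ⊕_) (∑-⊗ n (recip j) _))))) ⟩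
      ∑ (suc (suc p)) (λ j → S j ⊗ (∑ n (fallTerm (ev k x) j) ⊕ recip j ⊗ ∑ n (fallTerm (ev k x) (suc j)))) ∎))
    (λ _ → refl)
    (⇝-∑ (suc (suc p)) (λ j → ⇝-⊗ (λ _ → S j) (constant-bounded (S j))
      (⇝-⊕ (fallTerm-⇝ x j) (⇝-⊗ (λ _ → recip j) (constant-bounded (recip j)) (fallTerm-⇝ x (suc j))))))
    where
    open ≡-Reasoning
    S : ℕ → 𝔾
    S j = ν (stirling₂ (suc p) j)

-- Riemann sums of monomials

-- quot m a b = ∑ᵢ₊ⱼ₌ₘ aⁱ bʲ
quot : ℕ → 𝔾 → 𝔾 → 𝔾
quot zero    a b = ι 1ℚ
quot (suc m) a b = b ⊗ quot m a b ⊕ a ↑ suc m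

↑-⊖ : ∀ m a b → b ↑ suc m ⊖ a ↑ suc m ≡ quot m a b ⊗ (b ⊖ a)
↑-⊖ zero    a b = solve 2 (λ a b → b :* con 1ℚ :- a :* con 1ℚ := con 1ℚ :* (b :- a)) refl a b
↑-⊖ (suc m) a b = begin
  b ⊗ B ⊖ a ⊗ A
    ≡⟨ solve 4 (λ a b A B → b :* B :- a :* A := b :* (B :- A) :+ A :* (b :- a))
         refl a b A B ⟩
  b ⊗ (B ⊖ A) ⊕ A ⊗ (b ⊖ a)                   ≡⟨ cong (λ s → b ⊗ s ⊕ A ⊗ (b ⊖ a)) (↑-⊖ m a b) ⟩
  b ⊗ (quot m a b ⊗ (b ⊖ a)) ⊕ A ⊗ (b ⊖ a)
    ≡⟨ solve 4 (λ b q d A → b :* (q :* d) :+ A :* d := (b :* q :+ A) :* d)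
         refl b (quot m a b) (b ⊖ a) A ⟩
  (b ⊗ quot m a b ⊕ A) ⊗ (b ⊖ a)              ∎
  where
  open ≡-Reasoning
  A = a ↑ suc m
  B = b ↑ suc m

quot-diagonal : ∀ m c → quot m c c ≡ ν (suc m) ⊗ c ↑ m
quot-diagonal zero    c = sym (𝔾ₚ.*-identityˡ (ι 1ℚ))
quot-diagonal (suc m) c = begin
  c ⊗ quot m c c ⊕ c ⊗ c ↑ m               ≡⟨ cong (λ q → c ⊗ q ⊕ c ⊗ c ↑ m) (quot-diagonal m c) ⟩
  c ⊗ (ν (suc m) ⊗ c ↑ m) ⊕ c ⊗ c ↑ m
    ≡⟨ solve 3 (λ c n d → c :* (n :* d) :+ c :* d := (con 1ℚ :+ n) :* (c :* d))
         refl c (ν (suc m)) (c ↑ m) ⟩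
  (ν 1 ⊕ ν (suc m)) ⊗ (c ⊗ c ↑ m)          ≡⟨ cong (_⊗ (c ⊗ c ↑ m)) (ν-+ 1 (suc m)) ⟨
  ν (suc (suc m)) ⊗ (c ⊗ c ↑ m)            ∎
  where open ≡-Reasoning

∥⊕∥≤+ : ∀ {z w a b} → ∥ z ∥ ℚ.≤ a → ∥ w ∥ ℚ.≤ b → ∥ z ⊕ w ∥ ℚ.≤ a ℚ.+ b
∥⊕∥≤+ {z} {w} p q = ℚₚ.≤-trans (∥⊕∥≤ z w) (ℚₚ.+-mono-≤ p q)

∥⊗∥≤* : ∀ {z w a b} → ∥ z ∥ ℚ.≤ a → ∥ w ∥ ℚ.≤ b → ∥ z ⊗ w ∥ ℚ.≤ a ℚ.* b
∥⊗∥≤* {z} {w} p q = ℚₚ.≤-trans (∥⊗∥≤ z w)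
  (mul-mono (∥∥-nonneg w) (ℚₚ.≤-trans (∥∥-nonneg z) p) p q)

-- The constants found here depend on m and R alone, so they can be fixed before the mesh, the
-- partition and the index k.
module Ball (R : ℚ) where

  ↑-bounded : ∀ m → ∃[ B ] (∀ {a} → ∥ a ∥ ℚ.≤ R → ∥ a ↑ m ∥ ℚ.≤ B)
  ↑-bounded zero    = ∥ ι 1ℚ ∥ , λ _ → ℚₚ.≤-refl
  ↑-bounded (suc m) = let B , h = ↑-bounded m in R ℚ.* B , λ a≤R → ∥⊗∥≤* a≤R (h a≤R)

  quot-bounded : ∀ m → ∃[ B ] (∀ {a b} → ∥ a ∥ ℚ.≤ R → ∥ b ∥ ℚ.≤ R → ∥ quot m a b ∥ ℚ.≤ B)
  quot-bounded zero    = ∥ ι 1ℚ ∥ , λ _ _ → ℚₚ.≤-refl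
  quot-bounded (suc m) =
    let B , h = quot-bounded m
        C , g = ↑-bounded (suc m)
    in R ℚ.* B ℚ.+ C , λ a≤R b≤R → ∥⊕∥≤+ (∥⊗∥≤* b≤R (h a≤R b≤R)) (g a≤R)

  -- Source of the error O(μ |b - a|): (m + 1) cᵐ (b - a) and bᵐ⁺¹ - aᵐ⁺¹ are `quot m c c` and
  -- `quot m a b` times b - a, so only these factors need comparing. In the inductive step, the
  -- difference of the powers of c and a is factored once more by `↑-⊖`.
  quot-lipschitz : ∀ m → ∃[ C ] (∀ {a b c μ} → ∥ a ∥ ℚ.≤ R → ∥ b ∥ ℚ.≤ R → ∥ c ∥ ℚ.≤ R →
    ∥ c ⊖ a ∥ ℚ.≤ μ → ∥ c ⊖ b ∥ ℚ.≤ μ → ∥ quot m c c ⊖ quot m a b ∥ ℚ.≤ C ℚ.* μ)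
  quot-lipschitz zero    = 0ℚ , λ {_} {_} {_} {μ} _ _ _ _ _ →
    ℚₚ.≤-reflexive (trans (cong ∥_∥ (𝔾ₚ.-‿inverseʳ (ι 1ℚ))) (trans (∥ι∥ 0ℚ) (sym (ℚₚ.*-zeroˡ μ))))
  quot-lipschitz (suc m) =
    let C , lip   = quot-lipschitz m
        B , bound = quot-bounded m
    in R ℚ.* C ℚ.+ B ℚ.+ B , λ {a} {b} {c} {μ} a≤R b≤R c≤R c-a c-b → begin
      ∥ (c ⊗ quot m c c ⊕ c ↑ suc m) ⊖ (b ⊗ quot m a b ⊕ a ↑ suc m) ∥
        ≡⟨ cong ∥_∥ (solve 6 (λ b c p q C A → (c :* p :+ C) :- (b :* q :+ A) :=
             c :* (p :- q) :+ q :* (c :- b) :+ (C :- A)) refl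
             b c (quot m c c) (quot m a b) (c ↑ suc m) (a ↑ suc m)) ⟩
      ∥ c ⊗ (quot m c c ⊖ quot m a b) ⊕ quot m a b ⊗ (c ⊖ b) ⊕ (c ↑ suc m ⊖ a ↑ suc m) ∥
        ≡⟨ cong (λ s → ∥ c ⊗ (quot m c c ⊖ quot m a b) ⊕ quot m a b ⊗ (c ⊖ b) ⊕ s ∥) (↑-⊖ m a c) ⟩
      ∥ c ⊗ (quot m c c ⊖ quot m a b) ⊕ quot m a b ⊗ (c ⊖ b) ⊕ quot m a c ⊗ (c ⊖ a) ∥
        ≤⟨ ∥⊕∥≤+ (∥⊕∥≤+ (∥⊗∥≤* c≤R (lip a≤R b≤R c≤R c-a c-b)) (∥⊗∥≤* (bound a≤R b≤R) c-b))
                 (∥⊗∥≤* (bound a≤R c≤R) c-a) ⟩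
      R ℚ.* (C ℚ.* μ) ℚ.+ B ℚ.* μ ℚ.+ B ℚ.* μ
        ≡⟨ ℚ-solve 4 (λ R C B μ → R ⊛ (C ⊛ μ) ⊞ B ⊛ μ ⊞ B ⊛ μ ≔ (R ⊛ C ⊞ B ⊞ B) ⊛ μ) refl R C B μ ⟩
      (R ℚ.* C ℚ.+ B ℚ.+ B) ℚ.* μ ∎
    where
    open ℚₚ.≤-Reasoning

  -- z lists the points, c the tags. The increments of v dominate the lengths of the pieces, so the
  -- errors O(μ |z (suc i) - z i|) add up to O(μ v n).
  module _ (m n : ℕ) (z c : ℕ → 𝔾) (v : ℕ → ℚ) (μ : ℚ)
    (0≤μ : 0ℚ ℚ.≤ μ) (0≤v₀ : 0ℚ ℚ.≤ v 0)
    (variation : ∀ i → i ℕ.< n → v i ℚ.+ ∥ z (suc i) ⊖ z i ∥ ℚ.≤ v (suc i))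
    (z≤R : ∀ i → i ℕ.≤ n → ∥ z i ∥ ℚ.≤ R) (c≤R : ∀ i → i ℕ.< n → ∥ c i ∥ ℚ.≤ R)
    (c-z≤μ : ∀ i → i ℕ.< n → ∥ c i ⊖ z i ∥ ℚ.≤ μ)
    (c-z′≤μ : ∀ i → i ℕ.< n → ∥ c i ⊖ z (suc i) ∥ ℚ.≤ μ)
    where

    open ℚₚ.≤-Reasoning

    private
      C : ℚ
      C = proj₁ (quot-lipschitz m)

    -- No sign was recorded for C; but C μ bounds a norm, namely the one obtained when all three
    -- points are z 0.
    0≤C*μ : 0ℚ ℚ.≤ C ℚ.* μ
    0≤C*μ = ℚₚ.≤-trans (∥∥-nonneg _)
      (proj₂ (quot-lipschitz m) z₀≤R z₀≤R z₀≤R z₀-z₀≤μ z₀-z₀≤μ)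
      where
      z₀≤R = z≤R 0 ℕ.z≤n
      z₀-z₀≤μ : ∥ z 0 ⊖ z 0 ∥ ℚ.≤ μ
      z₀-z₀≤μ = ℚₚ.≤-trans (ℚₚ.≤-reflexive (trans (cong ∥_∥ (𝔾ₚ.-‿inverseʳ (z 0))) (∥ι∥ 0ℚ))) 0≤μ

    private
      summand : ℕ → 𝔾
      summand i = ν (suc m) ⊗ (c i ↑ m ⊗ (z (suc i) ⊖ z i))

      summand-estimate : ∀ i → i ℕ.< n →
        ∥ summand i ⊖ (z (suc i) ↑ suc m ⊖ z i ↑ suc m) ∥ ℚ.≤ C ℚ.* μ ℚ.* ∥ z (suc i) ⊖ z i ∥
      summand-estimate i i<n = begin
        ∥ summand i ⊖ (z (suc i) ↑ suc m ⊖ z i ↑ suc m) ∥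
          ≡⟨ cong (λ s → ∥ summand i ⊖ s ∥) (↑-⊖ m (z i) (z (suc i))) ⟩
        ∥ summand i ⊖ q ⊗ d ∥
          ≡⟨ cong ∥_∥ (solve 4 (λ n c d q → n :* (c :* d) :- q :* d := (n :* c :- q) :* d) refl
               (ν (suc m)) (c i ↑ m) d q) ⟩
        ∥ (ν (suc m) ⊗ c i ↑ m ⊖ q) ⊗ d ∥
          ≡⟨ cong (λ s → ∥ (s ⊖ q) ⊗ d ∥) (quot-diagonal m (c i)) ⟨
        ∥ (quot m (c i) (c i) ⊖ q) ⊗ d ∥
          ≤⟨ ∥⊗∥≤* (proj₂ (quot-lipschitz m) (z≤R i (ℕₚ.<⇒≤ i<n)) (z≤R (suc i) i<n) (c≤R i i<n)
                      (c-z≤μ i i<n) (c-z′≤μ i i<n)) ℚₚ.≤-refl ⟩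
        C ℚ.* μ ℚ.* ∥ d ∥ ∎
        where
        d = z (suc i) ⊖ z i
        q = quot m (z i) (z (suc i))

      partial-estimate : ∀ j → j ℕ.≤ n →
        ∥ ∑ j summand ⊖ (z j ↑ suc m ⊖ z 0 ↑ suc m) ∥ ℚ.≤ C ℚ.* μ ℚ.* v j
      partial-estimate zero    _   = begin
        ∥ ι 0ℚ ⊖ (z 0 ↑ suc m ⊖ z 0 ↑ suc m) ∥
          ≡⟨ cong ∥_∥ (solve 1 (λ z → con 0ℚ :- (z :- z) := con 0ℚ) refl (z 0 ↑ suc m)) ⟩
        ∥ ι 0ℚ ∥          ≡⟨ ∥ι∥ 0ℚ ⟩
        0ℚ                ≤⟨ mul-nonneg 0≤C*μ 0≤v₀ ⟩
        C ℚ.* μ ℚ.* v 0   ∎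
      partial-estimate (suc j) j<n = begin
        ∥ (∑ j summand ⊕ summand j) ⊖ (z (suc j) ↑ suc m ⊖ z 0 ↑ suc m) ∥
          ≡⟨ cong ∥_∥ (solve 5 (λ s t a b c → (s :+ t) :- (a :- c) := (s :- (b :- c)) :+ (t :- (a :- b))) refl
               (∑ j summand) (summand j) (z (suc j) ↑ suc m) (z j ↑ suc m) (z 0 ↑ suc m)) ⟩
        ∥ (∑ j summand ⊖ (z j ↑ suc m ⊖ z 0 ↑ suc m)) ⊕ (summand j ⊖ (z (suc j) ↑ suc m ⊖ z j ↑ suc m)) ∥
          ≤⟨ ∥⊕∥≤+ (partial-estimate j (ℕₚ.<⇒≤ j<n)) (summand-estimate j j<n) ⟩
        C ℚ.* μ ℚ.* v j ℚ.+ C ℚ.* μ ℚ.* ∥ z (suc j) ⊖ z j ∥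
          ≡⟨ ℚₚ.*-distribˡ-+ (C ℚ.* μ) (v j) _ ⟨
        C ℚ.* μ ℚ.* (v j ℚ.+ ∥ z (suc j) ⊖ z j ∥)
          ≤⟨ ℚₚ.*-monoˡ-≤-nonNeg (C ℚ.* μ) {{ℚ.nonNegative 0≤C*μ}} (variation j j<n) ⟩
        C ℚ.* μ ℚ.* v (suc j) ∎

    riemann-estimate : ∥ ∑ n summand ⊖ (z n ↑ suc m ⊖ z 0 ↑ suc m) ∥ ℚ.≤ C ℚ.* μ ℚ.* v n
    riemann-estimate = partial-estimate n ℕₚ.≤-refl

-- Turns a linear inequality into a ring identity: g is a nonnegative combination of the slacks of
-- known inequalities, and the solver checks a + g = b.
≤-by-gap : ∀ {a b} g → 0ℚ ℚ.≤ g → a ℚ.+ g ≡ b → a ℚ.≤ b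
≤-by-gap {a} g 0≤g eq =
  ℚₚ.≤-trans (ℚₚ.≤-reflexive (sym (ℚₚ.+-identityʳ a))) (subst (a ℚ.+ 0ℚ ℚ.≤_) eq (ℚₚ.+-monoʳ-≤ a 0≤g))

0≤+ : ∀ {a b} → 0ℚ ℚ.≤ a → 0ℚ ℚ.≤ b → 0ℚ ℚ.≤ a ℚ.+ b
0≤+ p q = ℚₚ.≤-trans (ℚₚ.≤-reflexive (sym (ℚₚ.+-identityˡ 0ℚ))) (ℚₚ.+-mono-≤ p q)

0≤- : ∀ {a b} → a ℚ.≤ b → 0ℚ ℚ.≤ b ℚ.- a
0≤- {a} p = ℚₚ.≤-trans (ℚₚ.≤-reflexive (sym (ℚₚ.+-inverseʳ a))) (ℚₚ.+-monoˡ-≤ (ℚ.- a) p)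

∣∣≤ : ∀ {a b} → a ℚ.≤ b → ℚ.- a ℚ.≤ b → ℚ.∣ a ∣ ℚ.≤ b
∣∣≤ {a} {b} p q with ℚₚ.∣p∣≡p∨∣p∣≡-p a
... | inj₁ eq = subst (ℚ._≤ b) (sym eq) p
... | inj₂ eq = subst (ℚ._≤ b) (sym eq) q

≤∣∣ : ∀ a → a ℚ.≤ ℚ.∣ a ∣
≤∣∣ a with ℚₚ.≤-total 0ℚ a
... | inj₁ 0≤a = ℚₚ.≤-reflexive (sym (ℚₚ.0≤p⇒∣p∣≡p 0≤a))
... | inj₂ a≤0 = ℚₚ.≤-trans a≤0 (ℚₚ.0≤∣p∣ a)

-≤∣∣ : ∀ a → ℚ.- a ℚ.≤ ℚ.∣ a ∣
-≤∣∣ a = subst (ℚ.- a ℚ.≤_) (ℚₚ.∣-p∣≡∣p∣ a) (≤∣∣ (ℚ.- a))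

monotone-≤ : ∀ (f : ℕ → ℚ) n → (∀ i → i ℕ.< n → f i ℚ.≤ f (suc i)) → ∀ i → i ℕ.≤ n → f i ℚ.≤ f n
monotone-≤ f zero    step i ℕ.z≤n = ℚₚ.≤-refl
monotone-≤ f (suc n) step i i≤1+n with ℕₚ.m≤n⇒m<n∨m≡n i≤1+n
... | inj₂ refl        = ℚₚ.≤-refl
... | inj₁ (ℕ.s≤s i≤n) = ℚₚ.≤-trans
  (monotone-≤ f n (λ j j<n → step j (ℕₚ.m≤n⇒m≤1+n j<n)) i i≤n) (step n ℕₚ.≤-refl)

∥ι⊗∥≤ : ∀ {a b x K} → ℚ.∣ a ∣ ℚ.≤ b → ∥ x ∥ ℚ.≤ K → ∥ ι a ⊗ x ∥ ℚ.≤ b ℚ.* K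
∥ι⊗∥≤ {a} {b} a≤b = ∥⊗∥≤* (subst (ℚ._≤ b) (sym (∥ι∥ a)) a≤b)

ι⊗-⊖ : ∀ a b x → ι a ⊗ x ⊖ ι b ⊗ x ≡ ι (a ℚ.- b) ⊗ x
ι⊗-⊖ a b x = trans (solve 3 (λ a b x → a :* x :- b :* x := (a :- b) :* x) refl (ι a) (ι b) x)
  (cong (_⊗ x) (sym (trans (ι-+ a (ℚ.- b)) (cong (ι a ⊕_) (ι-neg b)))))

-- The coefficient of δ in the total error. The first summand comes from the Riemann sum, with tags
-- within 3 δ K of the points and total length at most 7 K; the second from the last point being
-- only near x; the third from the first point being only near 0. Points and tags stay in the ball
-- of radius 11 K.
errorConstant : ℕ → ℚ → ℚ
errorConstant m K =
  proj₁ (quot-lipschitz m) ℚ.* (nat 3 ℚ.* K) ℚ.* (nat 7 ℚ.* K)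
    ℚ.+ proj₁ (quot-bounded m) ℚ.* K ℚ.+ K ℚ.* proj₁ (↑-bounded m)
  where open Ball (nat 11 ℚ.* K)

-- The inequalities of a tagged partition of [0, 1] at a single index of the
-- approximating sequences, where they hold only up to an error.
module ApproximatePartition (n : ℕ) (p t : ℕ → ℚ) (δ η : ℚ)
  (0≤δ : 0ℚ ℚ.≤ δ) (δ≤1 : δ ℚ.≤ 1ℚ) (0≤η : 0ℚ ℚ.≤ η) (η≤δ : η ℚ.≤ δ) (nη≤δ : nat n ℚ.* η ℚ.≤ δ)
  (first : ℚ.∣ p 0 ℚ.- 0ℚ ∣ ℚ.≤ δ) (last : ℚ.∣ p n ℚ.- 1ℚ ∣ ℚ.≤ δ)
  (p≤t : ∀ i → i ℕ.< n → p i ℚ.≤ t i ℚ.+ η)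
  (t≤p : ∀ i → i ℕ.< n → t i ℚ.≤ p (suc i) ℚ.+ η)
  (mesh : ∀ i → i ℕ.< n → p (suc i) ℚ.- p i ℚ.≤ δ ℚ.+ η)
  where

  open ℚₚ.≤-Reasoning

  -- A bound for the variation up to i: p may decrease, by at most 2η in each step.
  v : ℕ → ℚ
  v i = (p i ℚ.- p 0) ℚ.+ nat i ℚ.* (nat 4 ℚ.* η)

  v-zero : v 0 ≡ 0ℚ
  v-zero = ℚ-solve 2 (λ p η → (p ⊟ p) ⊞ ℚ-con 0ℚ ⊛ η ≔ ℚ-con 0ℚ) refl (p 0) (nat 4 ℚ.* η)

  variation : ∀ i → i ℕ.< n → v i ℚ.+ ℚ.∣ p (suc i) ℚ.- p i ∣ ℚ.≤ v (suc i)
  variation i i<n = begin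
    v i ℚ.+ ℚ.∣ p (suc i) ℚ.- p i ∣
      ≤⟨ ℚₚ.+-monoʳ-≤ (v i) (∣∣≤
           (≤-by-gap (nat 4 ℚ.* η) (mul-nonneg (frac-nonneg 4 1) 0≤η) refl)
           (≤-by-gap (gap ℚ.+ gap) (0≤+ 0≤gap 0≤gap)
             (ℚ-solve 4 (λ p q t η → ⊟ (q ⊟ p) ⊞ (((t ⊞ η ⊟ p) ⊞ (q ⊞ η ⊟ t)) ⊞ ((t ⊞ η ⊟ p) ⊞ (q ⊞ η ⊟ t)))
                         ≔ (q ⊟ p) ⊞ ℚ-con (nat 4) ⊛ η) refl (p i) (p (suc i)) (t i) η))) ⟩
    v i ℚ.+ ((p (suc i) ℚ.- p i) ℚ.+ nat 4 ℚ.* η)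
      ≡⟨ ℚ-solve 5 (λ o p q k h → ((p ⊟ o) ⊞ k ⊛ h) ⊞ ((q ⊟ p) ⊞ h) ≔ (q ⊟ o) ⊞ (ℚ-con 1ℚ ⊞ k) ⊛ h) refl
           (p 0) (p i) (p (suc i)) (nat i) (nat 4 ℚ.* η) ⟩
    (p (suc i) ℚ.- p 0) ℚ.+ (1ℚ ℚ.+ nat i) ℚ.* (nat 4 ℚ.* η)
      ≡⟨ cong (λ k → (p (suc i) ℚ.- p 0) ℚ.+ k ℚ.* (nat 4 ℚ.* η)) (nat-+ 1 i) ⟨
    v (suc i) ∎
    where
    -- For the increment d = p (suc i) - p i the two slacks add up to d + 2η. Hence d ≥ -2η and |d|
    -- ≤ d + 4η, which explains the 4 in `v`.
    gap = (t i ℚ.+ η ℚ.- p i) ℚ.+ (p (suc i) ℚ.+ η ℚ.- t i)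
    0≤gap : 0ℚ ℚ.≤ gap
    0≤gap = 0≤+ (0≤- (p≤t i i<n)) (0≤- (t≤p i i<n))

  -- At most 1 + δ from the last point, δ from the first and 4nη ≤ 4δ from the backward steps: 1 +
  -- 6δ ≤ 7.
  v-last : v n ℚ.≤ nat 7
  v-last = ≤-by-gap
    ((δ ℚ.- (p n ℚ.- 1ℚ)) ℚ.+ (δ ℚ.- (ℚ.- (p 0 ℚ.- 0ℚ))) ℚ.+ nat 4 ℚ.* (δ ℚ.- nat n ℚ.* η) ℚ.+ nat 6 ℚ.* (1ℚ ℚ.- δ))
    (0≤+ (0≤+ (0≤+ (0≤- (ℚₚ.≤-trans (≤∣∣ _) last)) (0≤- (ℚₚ.≤-trans (-≤∣∣ _) first)))
              (mul-nonneg (frac-nonneg 4 1) (0≤- nη≤δ)))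
         (mul-nonneg (frac-nonneg 6 1) (0≤- δ≤1)))
    (ℚ-solve 5 (λ o p k η δ → ((p ⊟ o) ⊞ k ⊛ (ℚ-con (nat 4) ⊛ η)) ⊞
        ((δ ⊟ (p ⊟ ℚ-con 1ℚ)) ⊞ (δ ⊟ (⊟ (o ⊟ ℚ-con 0ℚ))) ⊞ ℚ-con (nat 4) ⊛ (δ ⊟ k ⊛ η)
          ⊞ ℚ-con (nat 6) ⊛ (ℚ-con 1ℚ ⊟ δ))
        ≔ ℚ-con (nat 7)) refl (p 0) (p n) (nat n) η δ)

  v-step : ∀ i → i ℕ.< n → v i ℚ.≤ v (suc i)
  v-step i i<n = ℚₚ.≤-trans (≤-by-gap ℚ.∣ p (suc i) ℚ.- p i ∣ (ℚₚ.0≤∣p∣ (p (suc i) ℚ.- p i)) refl) (variation i i<n)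

  displacement : ∀ i → i ℕ.≤ n → ℚ.∣ p i ℚ.- p 0 ∣ ℚ.≤ v i
  displacement zero    _   = ℚₚ.≤-reflexive (trans (cong ℚ.∣_∣ (ℚₚ.+-inverseʳ (p 0))) (sym v-zero))
  displacement (suc i) i<n = begin
    ℚ.∣ p (suc i) ℚ.- p 0 ∣
      ≡⟨ cong ℚ.∣_∣ (ℚ-solve 3 (λ o p q → q ⊟ o ≔ (p ⊟ o) ⊞ (q ⊟ p)) refl (p 0) (p i) (p (suc i))) ⟩
    ℚ.∣ (p i ℚ.- p 0) ℚ.+ (p (suc i) ℚ.- p i) ∣         ≤⟨ ℚₚ.∣p+q∣≤∣p∣+∣q∣ (p i ℚ.- p 0) (p (suc i) ℚ.- p i) ⟩
    ℚ.∣ p i ℚ.- p 0 ∣ ℚ.+ ℚ.∣ p (suc i) ℚ.- p i ∣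
      ≤⟨ ℚₚ.+-monoˡ-≤ ℚ.∣ p (suc i) ℚ.- p i ∣ (displacement i (ℕₚ.<⇒≤ i<n)) ⟩
    v i ℚ.+ ℚ.∣ p (suc i) ℚ.- p i ∣                     ≤⟨ variation i i<n ⟩
    v (suc i)                                           ∎

  point-bounded : ∀ i → i ℕ.≤ n → ℚ.∣ p i ∣ ℚ.≤ nat 8
  point-bounded i i≤n = begin
    ℚ.∣ p i ∣
      ≡⟨ cong ℚ.∣_∣ (ℚ-solve 2 (λ p o → p ≔ (p ⊟ o) ⊞ (o ⊟ ℚ-con 0ℚ)) refl (p i) (p 0)) ⟩
    ℚ.∣ (p i ℚ.- p 0) ℚ.+ (p 0 ℚ.- 0ℚ) ∣      ≤⟨ ℚₚ.∣p+q∣≤∣p∣+∣q∣ (p i ℚ.- p 0) (p 0 ℚ.- 0ℚ) ⟩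
    ℚ.∣ p i ℚ.- p 0 ∣ ℚ.+ ℚ.∣ p 0 ℚ.- 0ℚ ∣    ≤⟨ ℚₚ.+-mono-≤
        (ℚₚ.≤-trans (displacement i i≤n) (ℚₚ.≤-trans (monotone-≤ v n v-step i i≤n) v-last))
        (ℚₚ.≤-trans first δ≤1) ⟩
    nat 7 ℚ.+ 1ℚ                              ≡⟨ nat-+ 7 1 ⟨
    nat 8                                     ∎

  -- With q the next point, t - p ≤ (q - p) + η ≤ δ + 2η ≤ 3δ; in the other direction p - t ≤ η. The
  -- remaining slacks only pad the sum to 3δ.
  tag-point : ∀ i → i ℕ.< n → ℚ.∣ t i ℚ.- p i ∣ ℚ.≤ nat 3 ℚ.* δ
  tag-point i i<n = ∣∣≤
    (≤-by-gap (g₂ ℚ.+ g₃ ℚ.+ g₄ ℚ.+ g₄) (0≤+ (0≤+ (0≤+ 0≤g₂ 0≤g₃) 0≤g₄) 0≤g₄)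
      (ℚ-solve 5 (λ p q t η δ → (t ⊟ p) ⊞ ((q ⊞ η ⊟ t) ⊞ (δ ⊞ η ⊟ (q ⊟ p)) ⊞ (δ ⊟ η) ⊞ (δ ⊟ η))
                  ≔ ℚ-con (nat 3) ⊛ δ) refl (p i) (p (suc i)) (t i) η δ))
    (≤-by-gap (g₁ ℚ.+ g₄ ℚ.+ δ ℚ.+ δ) (0≤+ (0≤+ (0≤+ 0≤g₁ 0≤g₄) 0≤δ) 0≤δ)
      (ℚ-solve 4 (λ p t η δ → ⊟ (t ⊟ p) ⊞ ((t ⊞ η ⊟ p) ⊞ (δ ⊟ η) ⊞ δ ⊞ δ)
                  ≔ ℚ-con (nat 3) ⊛ δ) refl (p i) (t i) η δ))
    where
    g₁ = t i ℚ.+ η ℚ.- p i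
    g₂ = p (suc i) ℚ.+ η ℚ.- t i
    g₃ = δ ℚ.+ η ℚ.- (p (suc i) ℚ.- p i)
    g₄ = δ ℚ.- η
    0≤g₁ = 0≤- (p≤t i i<n)
    0≤g₂ = 0≤- (t≤p i i<n)
    0≤g₃ = 0≤- (mesh i i<n)
    0≤g₄ = 0≤- η≤δ

  tag-next : ∀ i → i ℕ.< n → ℚ.∣ t i ℚ.- p (suc i) ∣ ℚ.≤ nat 3 ℚ.* δ
  tag-next i i<n = ∣∣≤
    (≤-by-gap (g₂ ℚ.+ g₄ ℚ.+ δ ℚ.+ δ) (0≤+ (0≤+ (0≤+ 0≤g₂ 0≤g₄) 0≤δ) 0≤δ)
      (ℚ-solve 4 (λ q t η δ → (t ⊟ q) ⊞ ((q ⊞ η ⊟ t) ⊞ (δ ⊟ η) ⊞ δ ⊞ δ)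
                  ≔ ℚ-con (nat 3) ⊛ δ) refl (p (suc i)) (t i) η δ))
    (≤-by-gap (g₁ ℚ.+ g₃ ℚ.+ g₄ ℚ.+ g₄) (0≤+ (0≤+ (0≤+ 0≤g₁ 0≤g₃) 0≤g₄) 0≤g₄)
      (ℚ-solve 5 (λ p q t η δ → ⊟ (t ⊟ q) ⊞ ((t ⊞ η ⊟ p) ⊞ (δ ⊞ η ⊟ (q ⊟ p)) ⊞ (δ ⊟ η) ⊞ (δ ⊟ η))
                  ≔ ℚ-con (nat 3) ⊛ δ) refl (p i) (p (suc i)) (t i) η δ))
    where
    g₁ = t i ℚ.+ η ℚ.- p i
    g₂ = p (suc i) ℚ.+ η ℚ.- t i
    g₃ = δ ℚ.+ η ℚ.- (p (suc i) ℚ.- p i)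
    g₄ = δ ℚ.- η
    0≤g₁ = 0≤- (p≤t i i<n)
    0≤g₂ = 0≤- (t≤p i i<n)
    0≤g₃ = 0≤- (mesh i i<n)
    0≤g₄ = 0≤- η≤δ

  tag-bounded : ∀ i → i ℕ.< n → ℚ.∣ t i ∣ ℚ.≤ nat 11
  tag-bounded i i<n = begin
    ℚ.∣ t i ∣                              ≡⟨ cong ℚ.∣_∣ (ℚ-solve 2 (λ t p → t ≔ (t ⊟ p) ⊞ p) refl (t i) (p i)) ⟩
    ℚ.∣ (t i ℚ.- p i) ℚ.+ p i ∣            ≤⟨ ℚₚ.∣p+q∣≤∣p∣+∣q∣ (t i ℚ.- p i) (p i) ⟩
    ℚ.∣ t i ℚ.- p i ∣ ℚ.+ ℚ.∣ p i ∣        ≤⟨ ℚₚ.+-mono-≤ (tag-point i i<n) (point-bounded i (ℕₚ.<⇒≤ i<n)) ⟩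
    nat 3 ℚ.* δ ℚ.+ nat 8                  ≤⟨ ℚₚ.+-monoˡ-≤ (nat 8)
                                                (ℚₚ.*-monoˡ-≤-nonNeg (nat 3) {{ℚ.nonNegative (frac-nonneg 3 1)}} δ≤1) ⟩
    nat 3 ℚ.* 1ℚ ℚ.+ nat 8                 ≡⟨ cong (ℚ._+ nat 8) (ℚₚ.*-identityʳ (nat 3)) ⟩
    nat 3 ℚ.+ nat 8                        ≡⟨ nat-+ 3 8 ⟨
    nat 11                                 ∎

  module _ (m : ℕ) (K : ℚ) (x : 𝔾) (x≤K : ∥ x ∥ ℚ.≤ K) where

    open Ball (nat 11 ℚ.* K)

    private
      z c : ℕ → 𝔾
      z i = ι (p i) ⊗ x
      c i = ι (t i) ⊗ x

      0≤K : 0ℚ ℚ.≤ K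
      0≤K = ℚₚ.≤-trans (∥∥-nonneg x) x≤K

      C B P μ : ℚ
      C = proj₁ (quot-lipschitz m)
      B = proj₁ (quot-bounded m)
      P = proj₁ (↑-bounded m)
      μ = nat 3 ℚ.* δ ℚ.* K

      0≤μ : 0ℚ ℚ.≤ μ
      0≤μ = mul-nonneg (mul-nonneg (frac-nonneg 3 1) 0≤δ) 0≤K

      widen : ∀ {a} k → k ℕ.≤ 11 → ℚ.∣ a ∣ ℚ.≤ nat k → ∥ ι a ⊗ x ∥ ℚ.≤ nat 11 ℚ.* K
      widen k k≤11 a≤k = ∥ι⊗∥≤ (ℚₚ.≤-trans a≤k (frac-≤ k 1 11 1 (ℕₚ.*-monoˡ-≤ 1 k≤11))) x≤K

      z≤R : ∀ i → i ℕ.≤ n → ∥ z i ∥ ℚ.≤ nat 11 ℚ.* K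
      z≤R i i≤n = widen 8 (ℕₚ.m≤m+n 8 3) (point-bounded i i≤n)

      x≤R : ∥ x ∥ ℚ.≤ nat 11 ℚ.* K
      x≤R = subst (λ y → ∥ y ∥ ℚ.≤ nat 11 ℚ.* K) (𝔾ₚ.*-identityˡ x)
        (widen {1ℚ} 1 (ℕₚ.m≤m+n 1 10) ℚₚ.≤-refl)

      difference : ∀ {a b d} → ℚ.∣ a ℚ.- b ∣ ℚ.≤ d → ∥ ι a ⊗ x ⊖ ι b ⊗ x ∥ ℚ.≤ d ℚ.* K
      difference {a} {b} {d} h = subst (λ y → ∥ y ∥ ℚ.≤ d ℚ.* K) (sym (ι⊗-⊖ a b x)) (∥ι⊗∥≤ h x≤K)

      zₙ-x : ∥ z n ⊖ x ∥ ℚ.≤ δ ℚ.* K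
      zₙ-x = subst (λ y → ∥ z n ⊖ y ∥ ℚ.≤ δ ℚ.* K) (𝔾ₚ.*-identityˡ x) (difference last)

      z₀≤ : ∥ z 0 ∥ ℚ.≤ δ ℚ.* K
      z₀≤ = ∥ι⊗∥≤ (subst (λ q → ℚ.∣ q ∣ ℚ.≤ δ) (ℚₚ.+-identityʳ (p 0)) first) x≤K

      sum : 𝔾
      sum = ∑ n (λ i → ν (suc m) ⊗ (c i ↑ m ⊗ (z (suc i) ⊖ z i)))

      sum-estimate : ∥ sum ⊖ (z n ↑ suc m ⊖ z 0 ↑ suc m) ∥ ℚ.≤ C ℚ.* μ ℚ.* (nat 7 ℚ.* K)
      sum-estimate = ℚₚ.≤-trans
        (riemann-estimate m n z c (λ i → v i ℚ.* K) μ 0≤μ 0≤v₀ steps z≤R c≤R near near′)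
        (ℚₚ.*-monoˡ-≤-nonNeg (C ℚ.* μ)
          {{ℚ.nonNegative (0≤C*μ m n z c (λ i → v i ℚ.* K) μ 0≤μ 0≤v₀ steps z≤R c≤R near near′)}}
          (ℚₚ.*-monoʳ-≤-nonNeg K {{ℚ.nonNegative 0≤K}} v-last))
        where
        0≤v₀ : 0ℚ ℚ.≤ v 0 ℚ.* K
        0≤v₀ = ℚₚ.≤-reflexive (sym (trans (cong (ℚ._* K) v-zero) (ℚₚ.*-zeroˡ K)))
        steps : ∀ i → i ℕ.< n → v i ℚ.* K ℚ.+ ∥ z (suc i) ⊖ z i ∥ ℚ.≤ v (suc i) ℚ.* K
        steps i i<n = begin
          v i ℚ.* K ℚ.+ ∥ z (suc i) ⊖ z i ∥
            ≤⟨ ℚₚ.+-monoʳ-≤ (v i ℚ.* K) (difference ℚₚ.≤-refl) ⟩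
          v i ℚ.* K ℚ.+ ℚ.∣ p (suc i) ℚ.- p i ∣ ℚ.* K
            ≡⟨ ℚₚ.*-distribʳ-+ K (v i) ℚ.∣ p (suc i) ℚ.- p i ∣ ⟨
          (v i ℚ.+ ℚ.∣ p (suc i) ℚ.- p i ∣) ℚ.* K
            ≤⟨ ℚₚ.*-monoʳ-≤-nonNeg K {{ℚ.nonNegative 0≤K}} (variation i i<n) ⟩
          v (suc i) ℚ.* K ∎
        c≤R : ∀ i → i ℕ.< n → ∥ c i ∥ ℚ.≤ nat 11 ℚ.* K
        c≤R i i<n = widen 11 ℕₚ.≤-refl (tag-bounded i i<n)
        near : ∀ i → i ℕ.< n → ∥ c i ⊖ z i ∥ ℚ.≤ μ
        near i i<n = difference (tag-point i i<n)
        near′ : ∀ i → i ℕ.< n → ∥ c i ⊖ z (suc i) ∥ ℚ.≤ μ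
        near′ i i<n = difference (tag-next i i<n)

    monomial-estimate : ∥ sum ⊖ x ↑ suc m ∥ ℚ.≤ errorConstant m K ℚ.* δ
    monomial-estimate = begin
      ∥ sum ⊖ x ↑ suc m ∥
        ≡⟨ cong ∥_∥ (solve 4 (λ s x zₙ z₀ → s :- x := (s :- (zₙ :- z₀)) :+ (zₙ :- x) :+ (:- z₀)) refl
             sum (x ↑ suc m) (z n ↑ suc m) (z 0 ↑ suc m)) ⟩
      ∥ (sum ⊖ (z n ↑ suc m ⊖ z 0 ↑ suc m)) ⊕ (z n ↑ suc m ⊖ x ↑ suc m) ⊕ ⊝ (z 0 ↑ suc m) ∥
        ≤⟨ ∥⊕∥≤+ (∥⊕∥≤+ sum-estimate at-last) at-first ⟩
      C ℚ.* μ ℚ.* (nat 7 ℚ.* K) ℚ.+ B ℚ.* (δ ℚ.* K) ℚ.+ δ ℚ.* K ℚ.* P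
        ≡⟨ ℚ-solve 5 (λ C B P δ K →
             C ⊛ (ℚ-con (nat 3) ⊛ δ ⊛ K) ⊛ (ℚ-con (nat 7) ⊛ K) ⊞ B ⊛ (δ ⊛ K) ⊞ δ ⊛ K ⊛ P
               ≔ (C ⊛ (ℚ-con (nat 3) ⊛ K) ⊛ (ℚ-con (nat 7) ⊛ K) ⊞ B ⊛ K ⊞ K ⊛ P) ⊛ δ) refl C B P δ K ⟩
      errorConstant m K ℚ.* δ ∎
      where
      at-last : ∥ z n ↑ suc m ⊖ x ↑ suc m ∥ ℚ.≤ B ℚ.* (δ ℚ.* K)
      at-last = subst (λ y → ∥ y ∥ ℚ.≤ B ℚ.* (δ ℚ.* K)) (sym (↑-⊖ m x (z n)))
        (∥⊗∥≤* (proj₂ (quot-bounded m) x≤R (z≤R n ℕₚ.≤-refl)) zₙ-x)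
      at-first : ∥ ⊝ (z 0 ↑ suc m) ∥ ℚ.≤ δ ℚ.* K ℚ.* P
      at-first = subst (ℚ._≤ δ ℚ.* K ℚ.* P) (sym (∥⊝∥ (z 0 ↑ suc m)))
        (∥⊗∥≤* z₀≤ (proj₂ (↑-bounded m) (z≤R 0 ℕ.z≤n)))

-- The integral and the series

-- Finitely many conditions share a threshold; this gives one index at which all pieces of a given
-- partition are controlled.
Eventually-∀< : ∀ {P : ℕ → ℕ → Set} n → (∀ i → i ℕ.< n → Eventually (P i)) →
                Eventually (λ k → ∀ i → i ℕ.< n → P i k)
Eventually-∀< zero    h = 0 , λ _ _ _ ()
Eventually-∀< {P} (suc n) h = Eventually-map extend
  (Eventually-∩ (Eventually-∀< n (λ i i<n → h i (ℕₚ.m≤n⇒m≤1+n i<n))) (h n ℕₚ.≤-refl))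
  where
  extend : ∀ k → (∀ i → i ℕ.< n → P i k) × P n k → ∀ i → i ℕ.< suc n → P i k
  extend k (below , at-n) i i<1+n with ℕₚ.m≤n⇒m<n∨m≡n i<1+n
  ... | inj₁ (ℕ.s≤s i<n) = below i i<n
  ... | inj₂ refl        = at-n

⊓-pos : ∀ {p q} → 0ℚ ℚ.< p → 0ℚ ℚ.< q → 0ℚ ℚ.< p ℚ.⊓ q
⊓-pos {p} {q} 0<p 0<q with ℚₚ.⊓-sel p q
... | inj₁ eq = subst (0ℚ ℚ.<_) (sym eq) 0<p
... | inj₂ eq = subst (0ℚ ℚ.<_) (sym eq) 0<q

MeshAtMost-mono : ∀ {δ δ′} P → δ ℚ.≤ δ′ → MeshAtMost δ P → MeshAtMost δ′ P
MeshAtMost-mono P δ≤δ′ h i i<n ε 0<ε =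
  Eventually-map (λ _ q → ℚₚ.≤-trans q (ℚₚ.+-monoˡ-≤ ε δ≤δ′)) (h i i<n ε 0<ε)

-- Segment integrals of monomials and of `φ`

module Segment where

  open TaggedPartition

  open Limit {TaggedPartition} {∃[ δ ] 0ℚ ℚ.< δ} (λ (δ , _) → MeshAtMost δ) (1ℚ , frac-pos 0)
    (λ (δ , 0<δ) (δ′ , 0<δ′) → (δ ℚ.⊓ δ′ , ⊓-pos 0<δ 0<δ′) , λ P h →
      MeshAtMost-mono P (ℚₚ.p⊓q≤p δ δ′) h , MeshAtMost-mono P (ℚₚ.p⊓q≤q δ δ′) h) public

  tagOn pointOn : ℂ → TaggedPartition → ℕ → ℕ → 𝔾
  tagOn   x P k i = ι (seq (tag P i) k) ⊗ ev k x
  pointOn x P k i = ι (seq (point P i) k) ⊗ ev k x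

  monomialSum : ℕ → ℂ → TaggedPartition → ℕ → 𝔾
  monomialSum m x P k =
    ∑ (size P) (λ i → tagOn x P k i ↑ m ⊗ (pointOn x P k (suc i) ⊖ pointOn x P k i))

  -- The factor m + 1 stays on the left so that the telescoping powers appear undivided;
  -- `monomialSum-⇝` divides afterwards.
  monomial-⇝ : ∀ m x → (λ P k → ν (suc m) ⊗ monomialSum m x P k) ⇝ (λ k → ev k x ↑ suc m)
  monomial-⇝ m x ε 0<ε = (δ , 0<δ) , λ P mesh →
    let open Partition P mesh in Eventually-map close conditions
    where
    open ℚₚ.≤-Reasoning
    K = nat (suc (proj₁ (ev-bounded x)))
    N = proj₁ (archimedean (errorConstant m K))
    ε/N = ε ℚ.* (+ 1 ℚ./ suc N)
    -- The first argument makes the total error at most ε; the cap at 1 supports the absolute bounds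
    -- 7, 8 and 11.
    δ = ε/N ℚ.⊓ 1ℚ

    0<δ : 0ℚ ℚ.< δ
    0<δ = ⊓-pos (scale-pos N 0<ε) (frac-pos 0)

    0≤δ : 0ℚ ℚ.≤ δ
    0≤δ = ℚₚ.<⇒≤ 0<δ

    error≤ε : errorConstant m K ℚ.* δ ℚ.≤ ε
    error≤ε = begin
      errorConstant m K ℚ.* δ
        ≤⟨ ℚₚ.*-monoʳ-≤-nonNeg δ {{ℚ.nonNegative 0≤δ}} (proj₂ (archimedean (errorConstant m K))) ⟩
      nat (suc N) ℚ.* δ
        ≤⟨ ℚₚ.*-monoˡ-≤-nonNeg (nat (suc N)) {{ℚ.nonNegative (frac-nonneg (suc N) 1)}} (ℚₚ.p⊓q≤p ε/N 1ℚ) ⟩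
      nat (suc N) ℚ.* ε/N
        ≡⟨ rescale N ε ⟩
      ε ∎

    module Partition (P : TaggedPartition) (mesh : MeshAtMost δ P) where
      n = size P
      -- Dividing by n + 1 avoids a case n = 0 and yields both η ≤ δ and n η ≤ δ.
      η = δ ℚ.* (+ 1 ℚ./ suc n)

      0<η : 0ℚ ℚ.< η
      0<η = scale-pos n 0<δ

      multiple≤δ : ∀ j → j ℕ.≤ suc n → nat j ℚ.* η ℚ.≤ δ
      multiple≤δ j j≤1+n = begin
        nat j ℚ.* η         ≤⟨ ℚₚ.*-monoʳ-≤-nonNeg η {{ℚ.nonNegative (ℚₚ.<⇒≤ 0<η)}}
                                 (frac-≤ j 1 (suc n) 1 (ℕₚ.*-monoˡ-≤ 1 j≤1+n)) ⟩
        nat (suc n) ℚ.* η   ≡⟨ rescale n δ ⟩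
        δ                   ∎

      p t : ℕ → ℕ → ℚ
      p k i = seq (point P i) k
      t k i = seq (tag P i) k

      Conditions : ℕ → Set
      Conditions k = (∥ ev k x ∥ ℚ.≤ K)
        × (ℚ.∣ p k 0 ℚ.- 0ℚ ∣ ℚ.≤ δ) × (ℚ.∣ p k n ℚ.- 1ℚ ∣ ℚ.≤ δ)
        × (∀ i → i ℕ.< n → p k i ℚ.≤ t k i ℚ.+ η)
        × (∀ i → i ℕ.< n → t k i ℚ.≤ p k (suc i) ℚ.+ η)
        × (∀ i → i ℕ.< n → p k (suc i) ℚ.- p k i ℚ.≤ δ ℚ.+ η)

      conditions : Eventually Conditions
      conditions =
        Eventually-∩ (proj₂ (ev-bounded x)) (
        Eventually-∩ (point-first P δ 0<δ) (
        Eventually-∩ (point-last P δ 0<δ) (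
        Eventually-∩ (Eventually-∀< n (λ i i<n → point≤tag P i i<n η 0<η)) (
        Eventually-∩ (Eventually-∀< n (λ i i<n → tag≤point P i i<n η 0<η))
                     (Eventually-∀< n (λ i i<n → mesh i i<n η 0<η))))))

      close : ∀ k → Conditions k → ∥ ν (suc m) ⊗ monomialSum m x P k ⊖ ev k x ↑ suc m ∥ ℚ.≤ ε
      close k (x≤K , first , last , p≤t , t≤p , gaps) = begin
        ∥ ν (suc m) ⊗ monomialSum m x P k ⊖ ev k x ↑ suc m ∥
          ≡⟨ cong (λ s → ∥ s ⊖ ev k x ↑ suc m ∥) (∑-⊗ n (ν (suc m)) _) ⟨
        ∥ ∑ n (λ i → ν (suc m) ⊗ (tagOn x P k i ↑ m ⊗ (pointOn x P k (suc i) ⊖ pointOn x P k i))) ⊖ ev k x ↑ suc m ∥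
          ≤⟨ ApproximatePartition.monomial-estimate n (p k) (t k) δ η 0≤δ (ℚₚ.p⊓q≤q ε/N 1ℚ) (ℚₚ.<⇒≤ 0<η)
               (subst (ℚ._≤ δ) (ℚₚ.*-identityˡ η) (multiple≤δ 1 (ℕ.s≤s ℕ.z≤n)))
               (multiple≤δ n (ℕₚ.n≤1+n n)) first last p≤t t≤p gaps m K (ev k x) x≤K ⟩
        errorConstant m K ℚ.* δ
          ≤⟨ error≤ε ⟩
        ε ∎

  monomialSum-⇝ : ∀ m x → monomialSum m x ⇝ (λ k → recip m ⊗ ev k x ↑ suc m)
  monomialSum-⇝ m x = ⇝-resp
    (λ P k → begin
      recip m ⊗ (ν (suc m) ⊗ monomialSum m x P k)   ≡⟨ solve 3 (λ r n s → r :* (n :* s) := (n :* r) :* s) refl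
                                                          (recip m) (ν (suc m)) (monomialSum m x P k) ⟩
      ν (suc m) ⊗ recip m ⊗ monomialSum m x P k     ≡⟨ cong (_⊗ monomialSum m x P k) (ν-recip m) ⟩
      ι 1ℚ ⊗ monomialSum m x P k                    ≡⟨ 𝔾ₚ.*-identityˡ _ ⟩
      monomialSum m x P k                           ∎)
    (λ _ → refl)
    (⇝-⊗ (λ _ → recip m) (constant-bounded (recip m)) (monomial-⇝ m x))
    where open ≡-Reasoning

  opaque
    unfolding ev

    ev-segment : ∀ k r x → ev k (ofℝ r * x) ≡ ι (seq r k) ⊗ ev k x
    ev-segment k r x = refl

    ev-riemannSum : ∀ k f x P → ev k (riemannSum f x P) ≡
      ∑ (size P) (λ i → ev k (f (ofℝ (tag P i) * x)) ⊗ (pointOn x P k (suc i) ⊖ pointOn x P k i))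
    ev-riemannSum k f x P = trans (ev-∑ k (size P) _) (∑-cong (size P) (λ i → refl))

  ev-riemannSum-φ : ∀ k p x P → ev k (riemannSum (φ p) x P) ≡
    ∑ (suc p) (λ j → ν (stirling₂ p j) ⊗ monomialSum j x P k)
  ev-riemannSum-φ k p x P = begin
    ev k (riemannSum (φ p) x P)
      ≡⟨ ev-riemannSum k (φ p) x P ⟩
    ∑ (size P) (λ i → ev k (φ p (ofℝ (tag P i) * x)) ⊗ d i)
      ≡⟨ ∑-cong (size P) (λ i → trans (𝔾ₚ.*-comm _ (d i)) (cong (d i ⊗_) (ev-φ k p (ofℝ (tag P i) * x)))) ⟩
    ∑ (size P) (λ i → d i ⊗ ∑ (suc p) (λ j → S j ⊗ ev k (ofℝ (tag P i) * x) ↑ j))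
      ≡⟨ ∑-cong (size P) (λ i → trans (sym (∑-⊗ (suc p) (d i) _)) (∑-cong (suc p) (λ j → trans
           (solve 3 (λ d s c → d :* (s :* c) := s :* (c :* d)) refl (d i) (S j) (ev k (ofℝ (tag P i) * x) ↑ j))
           (cong (λ c → S j ⊗ (c ↑ j ⊗ d i)) (ev-segment k (tag P i) x))))) ⟩
    ∑ (size P) (λ i → ∑ (suc p) (λ j → S j ⊗ (tagOn x P k i ↑ j ⊗ d i)))
      ≡⟨ ∑-swap (size P) (suc p) _ ⟩
    ∑ (suc p) (λ j → ∑ (size P) (λ i → S j ⊗ (tagOn x P k i ↑ j ⊗ d i)))
      ≡⟨ ∑-cong (suc p) (λ j → ∑-⊗ (size P) (S j) _) ⟩
    ∑ (suc p) (λ j → S j ⊗ monomialSum j x P k) ∎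
    where
    open ≡-Reasoning
    S : ℕ → 𝔾
    S j = ν (stirling₂ p j)
    d : ℕ → 𝔾
    d i = pointOn x P k (suc i) ⊖ pointOn x P k i

  φ-⇝ : ∀ p x → (λ P k → ∑ (suc p) (λ j → ν (stirling₂ p j) ⊗ monomialSum j x P k)) ⇝
                (λ k → ∑ (suc p) (λ j → ν (stirling₂ p j) ⊗ (recip j ⊗ ev k x ↑ suc j)))
  φ-⇝ p x = ⇝-∑ (suc p) (λ j →
    ⇝-⊗ (λ _ → ν (stirling₂ p j)) (constant-bounded (ν (stirling₂ p j))) (monomialSum-⇝ j x))

  ⇝⇒HasSegmentIntegral : ∀ f x I → (λ P k → ev k (riemannSum f x P)) ⇝ (λ k → ev k I) →
                         HasSegmentIntegral f x I
  ⇝⇒HasSegmentIntegral f x I lim ε 0<ε =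
    let (δ , 0<δ) , h = lim ε 0<ε in δ , 0<δ , λ P mesh →
    ∥∥≤⇒∣∣≤ (riemannSum f x P - I) ε (Eventually-map
      (λ k → subst (ℚ._≤ ε) (cong ∥_∥ (sym (ev-- k (riemannSum f x P) I))))
      (h P mesh))

integralTerm : ℕ → ℂ → ℕ → ℂ
integralTerm p x k = ofℕ (stirling₂ p k) * (x ^ suc k ÷ suc k)

-- The witness for the integral: the termwise antiderivative of `φ p` that vanishes at 0.
∫φ : ℕ → ℂ → ℂ
∫φ p x = ∑< (suc p) (integralTerm p x)

opaque
  unfolding ev

  ev-integralTerm : ∀ k p x j →
    ev k (integralTerm p x j) ≡ ν (stirling₂ p j) ⊗ (recip j ⊗ ev k (x ^ suc j))
  ev-integralTerm k p x j = refl

  ev-closedForm-^ : ∀ k p x e n →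
    ev k (e * ∑< n (λ k → ofℕ (stirling₂ p k) * (x ^ k + x ^ suc k ÷ suc k))) ≡
    ev k e ⊗ ∑ n (λ j → ν (stirling₂ p j) ⊗ (ev k (x ^ j) ⊕ recip j ⊗ ev k (x ^ suc j)))
  ev-closedForm-^ k p x e n = cong (ev k e ⊗_) (trans (ev-∑ k n _) (∑-cong n (λ j → refl)))

ev-∫φ : ∀ k p x → ev k (∫φ p x) ≡ ∑ (suc p) (λ j → ν (stirling₂ p j) ⊗ (recip j ⊗ ev k x ↑ suc j))
ev-∫φ k p x = trans (ev-∑ k (suc p) (integralTerm p x))
  (∑-cong (suc p) (λ j → trans (ev-integralTerm k p x j)
    (cong (λ y → ν (stirling₂ p j) ⊗ (recip j ⊗ y)) (ev-^ k x (suc j)))))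

-- A common normal form: the limit of the series and the closed form are both compared with this
-- right-hand side.
ev-value : ∀ k p x e → ev k (e * φ p x + e * ∫φ p x) ≡
  ev k e ⊗ ∑ (suc p) (λ j → ν (stirling₂ p j) ⊗ (ev k x ↑ j ⊕ recip j ⊗ ev k x ↑ suc j))
ev-value k p x e = begin
  ev k (e * φ p x + e * ∫φ p x)
    ≡⟨ ev-+ k (e * φ p x) (e * ∫φ p x) ⟩
  ev k (e * φ p x) ⊕ ev k (e * ∫φ p x)
    ≡⟨ cong₂ _⊕_ (ev-* k e (φ p x)) (ev-* k e (∫φ p x)) ⟩
  ev k e ⊗ ev k (φ p x) ⊕ ev k e ⊗ ev k (∫φ p x)
    ≡⟨ 𝔾ₚ.distribˡ (ev k e) (ev k (φ p x)) (ev k (∫φ p x)) ⟨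
  ev k e ⊗ (ev k (φ p x) ⊕ ev k (∫φ p x))
    ≡⟨ cong (ev k e ⊗_) (trans (cong₂ _⊕_ (ev-φ k p x) (ev-∫φ k p x)) (trans (sym (∑-⊕ (suc p) _ _))
         (∑-cong (suc p) (λ j → sym (𝔾ₚ.distribˡ (ν (stirling₂ p j)) (ev k x ↑ j) _))))) ⟩
  ev k e ⊗ ∑ (suc p) (λ j → ν (stirling₂ p j) ⊗ (ev k x ↑ j ⊕ recip j ⊗ ev k x ↑ suc j)) ∎
  where open ≡-Reasoning

ev-closedForm : ∀ k p x e n →
  ev k (e * ∑< n (λ k → ofℕ (stirling₂ p k) * (x ^ k + x ^ suc k ÷ suc k))) ≡
  ev k e ⊗ ∑ n (λ j → ν (stirling₂ p j) ⊗ (ev k x ↑ j ⊕ recip j ⊗ ev k x ↑ suc j))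
ev-closedForm k p x e n = trans (ev-closedForm-^ k p x e n)
  (cong (ev k e ⊗_) (∑-cong n (λ j →
    cong₂ (λ y y′ → ν (stirling₂ p j) ⊗ (y ⊕ recip j ⊗ y′)) (ev-^ k x j) (ev-^ k x (suc j)))))

powerSum-HasSum : ∀ p x → HasSum (λ n → ofℕ (powerSum (suc p) (suc n)) * expTerm x (suc n))
                                 (exp x * φ (suc p) x + exp x * ∫φ (suc p) x)
powerSum-HasSum p x = ⇝⇒HasSum (⇝-resp
  -- The series in the statement begins at n = 1. The additional head term at 0 vanishes because the
  -- empty power sum is 0.
  (λ n k → trans (∑-head n _) (trans (cong₂ _⊕_ (𝔾ₚ.zeroˡ (term (ev k x) 0))
    (∑-cong n (λ i → sym (trans (ev-ofℕ-* k (powerSum (suc p) (suc i)) (expTerm x (suc i)))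
      (cong (ν (powerSum (suc p) (suc i)) ⊗_) (ev-expTerm k x (suc i)))))))
    (𝔾ₚ.+-identityˡ _)))
  (λ k → sym (trans (ev-value k (suc p) x (exp x)) (trans (sym (∑-⊗ (suc (suc p)) (ev k (exp x)) _))
    (∑-cong (suc (suc p)) (λ j →
      solve 5 (λ e s a r b → e :* (s :* (a :+ r :* b)) := s :* (a :* e :+ r :* (b :* e))) refl
        (ev k (exp x)) (ν (stirling₂ (suc p) j)) (ev k x ↑ j) (recip j) (ev k x ↑ suc j))))))
  (⇝-tail (powerSum-⇝ p x)))
  where open Sequence

φ-HasSegmentIntegral : ∀ p x → HasSegmentIntegral (φ p) x (∫φ p x)
φ-HasSegmentIntegral p x = ⇝⇒HasSegmentIntegral (φ p) x (∫φ p x)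
  (⇝-resp (λ P k → sym (ev-riemannSum-φ k p x P)) (λ k → sym (ev-∫φ k p x)) (φ-⇝ p x))
  where open Segment

value≈closedForm : ∀ p x → exp x * φ p x + exp x * ∫φ p x ≈
  exp x * ∑< (suc p) (λ k → ofℕ (stirling₂ p k) * (x ^ k + x ^ suc k ÷ suc k))
value≈closedForm p x =
  ev-injective (λ k → trans (ev-value k p x (exp x)) (sym (ev-closedForm k p x (exp x) (suc p))))

mainTheorem2 : (p : ℕ) .{{_ : NonZero p}} (x : ℂ) →
    ∃[ I ] ( HasSegmentIntegral (φ p) x I
    × HasSum (λ n → ofℕ (powerSum p (suc n)) * expTerm x (suc n))
    (exp x * φ p x + exp x * I)
    × exp x * φ p x + exp x * I
    ≈ exp x * ∑< (suc p) (λ k → ofℕ (stirling₂ p k) * (x ^ k + x ^ suc k ÷ suc k)) )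
mainTheorem2 (suc p) x =
  ∫φ (suc p) x , φ-HasSegmentIntegral (suc p) x , powerSum-HasSum p x , value≈closedForm (suc p) x
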